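{- Let $G=\bigoplus_{i=1}^n\bigoplus_{j=1}^{n_i}C_{p_i^{e_{ij}}}$ be a finite abelian group (written as a direct sum of prime-power cyclic groups, with $p_1,\dots,p_n$ distinct primes) such that $k(G)=k^*(G)$. Let $S$ be a UFIM over $G\setminus\{0\}$ with irreducible factorization $\bigsqcup_{i=1}^m I_i$. If $$m\le\sum_{i=1}^n\sum_{j=1}^{n_i}\frac{P^-(|G|)}{p_i}K_1^*(C_{p_i^{e_{ij}}}),$$ then $k(S)\le K_1^*(G)$. In particular, for a finite abelian $p$-group $G$ ($p$ prime) and a UFIM $S$ over $G\setminus\{0\}$ with $m$ irreducible factors, if $m\le K_1^*(G)$, then $k(S)\le K_1^*(G)$.
   Context: Groups are finite abelian, written additively; $C_n$ is the cyclic group of order $n$. An indexed multiset $S=\{g_1,\ldots,g_\ell\}$ over a set $X\subseteq G$ is a finite (possibly empty) indexed family of elements of $X$; for $I\subseteq[\ell]$ put $S(I)=\{g_i : i\in I\}$, and submultisets of $S$ are the $S(I)$. Put $\sigma(S)=\sum_{g\in S}g$ (with multiplicity), $\sigma(\emptyset)=0$. $S$ is zero-sum if $\sigma(S)=0$; minimal zero-sum if $\sigma(S)=0$ and $\sigma(S')\ne0$ for every $\emptyset\subsetneq S'\subsetneq S$; zero-sum free if $\sigma(S')\neq0$ for every $\emptyset\subsetneq S'\subseteq S$. An irreducible factorization of $S$ over $G\setminus\{0\}$ is a partition $[\ell]=\bigsqcup_{i=1}^m I_i$ into nonempty sets with each $S(I_i)$ minimal zero-sum (the $S(I_i)$ are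 the irreducible factors); two factorizations are equivalent iff they are the same set of blocks $\{I_1,\ldots,I_m\}$. A unique factorization indexed multiset (UFIM) over $G\setminus\{0\}$ is a zero-sum indexed multiset over $G\setminus\{0\}$ with exactly one irreducible factorization up to equivalence. The cross number of $S$ is $k(S)=\sum_{g\in S}\frac1{\mathrm{ord}(g)}$ (with multiplicity; $k(\emptyset)=0$), and $k(G)=\max\{k(S): S\text{ is a zero-sum free indexed multiset over }G\setminus\{0\}\}$. For $G=\bigoplus_{i=1}^n\bigoplus_{j=1}^{n_i}C_{p_i^{e_{ij}}}$ with distinct primes $p_i$ and $e_{ij}\ge1$, put $K_1^*(G)=\sum_{i=1}^n\sum_{j=1}^{n_i}\frac{p_i^{e_{ij}}-1}{p_i^{e_{ij}}-p_i^{e_{ij}-1}}$ and $k^*(G)=\sum_{i=1}^n\sum_{j=1}^{n_i}\frac{p_i^{e_{ij}}-1}{p_i^{e_{ij}}}$. $P^-(N)$ denotes the smallest prime divisor of $N$. -}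

module Defs where

open import Algebra.Bundles using (AbelianGroup)
open import Algebra.Morphism.Structures using (module GroupMorphisms)
import Algebra.Properties.CommutativeMonoid.Sum as CommutativeMonoidSum
import Algebra.Properties.Group as GroupProperties
import Algebra.Properties.Monoid.Mult as MonoidMult
open import Data.Bool.Base using (if_then_else_)
open import Data.Fin.Base using (Fin)
open import Data.Fin.Permutation using (Permutation′; permutation; _⟨$⟩ʳ_)
import Data.Fin.Properties as Fin
open import Data.Fin.Subset using (Subset; Nonempty; _∈_; _∩_; _⊂_; ⊤; Empty)
open import Data.Integer.Base as ℤ using (ℤ; +_; 0ℤ)
open import Data.Integer.Divisibility.Signed as ℤ using (divides; ∣m∣n⇒∣m+n; ∣m⇒∣-m)
import Data.Integer.Properties as ℤ
open import Data.Integer.Tactic.RingSolver using (solve-∀)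
open import Data.List.Base using ([]; _∷_; product)
open import Data.List.Relation.Unary.All using (_∷_)
open import Data.Nat.Base as ℕ using (ℕ; zero; suc; NonZero; _∸_; _^_; s≤s; s<s⁻¹)
open import Data.Nat.Divisibility as ℕ using (_∣_; _∣?_)
open import Data.Nat.Primality using (Prime; prime?; prime⇒nonZero; prime⇒nonTrivial)
open import Data.Nat.Primality.Factorisation using (factorise; module PrimeFactorisation)
import Data.Nat.Properties as ℕ
open import Data.Product.Base using (∃-syntax; Σ-syntax; _×_; _,_; proj₁; proj₂)
open import Data.Rational.Base using (ℚ; _/_; _*_; _≤_)
import Data.Rational.Properties as ℚ
open import Data.Vec.Base using (lookup)
open import Data.Vec.Functional using (Vector)
open import Function.Base using (_∘_)
open import Function.Bundles using (Inverse)
open import Function.Definitions using (Injective)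
open import Level using (0ℓ; _⊔_) renaming (suc to lsuc)
open import Relation.Binary.Definitions using (Decidable)
open import Relation.Binary.PropositionalEquality as ≡ using (_≡_; _≢_)
import Relation.Binary.Reasoning.Setoid as SetoidReasoning
open import Relation.Nullary.Decidable using (yes; no; map′; _×-dec_)
open import Relation.Nullary.Negation using (¬_; contradiction)
open import Relation.Unary as Unary using (Pred)

open CommutativeMonoidSum ℚ.+-0-commutativeMonoid public
  using (sum-syntax)

-- The least n ≤ b satisfying P; equal to b if there is none.
least : ∀ {a} {P : Pred ℕ a} → Unary.Decidable P → ℕ → ℕ
least P? zero    = zero
least P? (suc b) with P? 0
... | yes _ = 0
... | no  _ = suc (least (P? ∘ suc) b)

least-satisfies : ∀ {a} {P : Pred ℕ a} (P? : Unary.Decidable P) b {k} →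
                  k ℕ.≤ b → P k → P (least P? b)
least-satisfies P? zero    {zero} _ Pk = Pk
least-satisfies P? (suc b) {k} k≤b Pk with P? 0
... | yes P0 = P0
least-satisfies P? (suc b) {zero}  k≤b       Pk | no ¬P0 = contradiction Pk ¬P0
least-satisfies P? (suc b) {suc k} (s≤s k≤b) Pk | no _   = least-satisfies (P? ∘ suc) b k≤b Pk

least-minimal : ∀ {a} {P : Pred ℕ a} (P? : Unary.Decidable P) b {k} →
                k ℕ.< least P? b → ¬ P k
least-minimal P? (suc b) {k} k< with P? 0
least-minimal P? (suc b) {zero}  k< | no ¬P0 = ¬P0
least-minimal P? (suc b) {suc k} k< | no _   = least-minimal (P? ∘ suc) b (s<s⁻¹ k<)

-- Junk value P⁻ 1 = 1: the trivial group has no cyclic summand, so it is never used there.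
P⁻ : ℕ → ℕ
P⁻ N = least (λ q → prime? q ×-dec (q ∣? N)) N

P⁻-smallestPrimeDivisor : ∀ {N} → 1 ℕ.< N →
  Prime (P⁻ N) × P⁻ N ∣ N × (∀ {q} → Prime q → q ∣ N → P⁻ N ℕ.≤ q)
P⁻-smallestPrimeDivisor {N@(suc _)} 1<N = proj₁ sat , proj₂ sat , minimal
  where
  Q? = λ q → prime? q ×-dec (q ∣? N)

  primeDivisor : ∃[ q ] Prime q × q ∣ N
  primeDivisor with factorise N
  ... | record { factors = [] ; isFactorisation = eq } = contradiction (≡.sym eq) (ℕ.<⇒≢ 1<N)
  ... | record { factors = q ∷ qs ; isFactorisation = eq ; factorsPrime = pq ∷ _ } =
    q , pq , ≡.subst (q ∣_) (≡.sym eq) (ℕ.m∣m*n (product qs))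

  sat : Prime (P⁻ N) × P⁻ N ∣ N
  sat = let q , pq , q∣N = primeDivisor in least-satisfies Q? N (ℕ.∣⇒≤ q∣N) (pq , q∣N)

  minimal : ∀ {q} → Prime q → q ∣ N → P⁻ N ℕ.≤ q
  minimal pq q∣N = ℕ.≮⇒≥ λ q< → least-minimal Q? N q< (pq , q∣N)

infix 4 _≡_[mod_]

record _≡_[mod_] (a b : ℤ) (m : ℕ) : Set where
  constructor mod
  field divisible : + m ℤ.∣ a ℤ.- b

open _≡_[mod_] public

-- The cyclic group ℤ/mℤ, as a setoid quotient of ℤ.
C : ℕ → AbelianGroup 0ℓ 0ℓ
C m = record
  { Carrier = ℤ
  ; _≈_     = _≡_[mod m ]
  ; _∙_     = ℤ._+_
  ; ε       = 0ℤ
  ; _⁻¹     = ℤ.-_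
  ; isAbelianGroup = record
    { isGroup = record
      { isMonoid = record
        { isSemigroup = record
          { isMagma = record
            { isEquivalence = record
              { refl  = reflexive ≡.refl
              ; sym   = λ {a} {b} (mod d) → mod (≡.subst (+ m ℤ.∣_) (neg-sub a b) (∣m⇒∣-m d))
              ; trans = λ {a} {b} {c} (mod d) (mod d′) →
                  mod (≡.subst (+ m ℤ.∣_) (sub-sub a b c) (∣m∣n⇒∣m+n d d′))
              }
            ; ∙-cong = λ {a} {a′} {b} {b′} (mod d) (mod d′) →
                mod (≡.subst (+ m ℤ.∣_) (sub-add a a′ b b′) (∣m∣n⇒∣m+n d d′))
            }
          ; assoc = λ a b c → reflexive (ℤ.+-assoc a b c)
          }
        ; identity = reflexive ∘ ℤ.+-identityˡ , reflexive ∘ ℤ.+-identityʳ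
        }
      ; inverse = reflexive ∘ ℤ.+-inverseˡ , reflexive ∘ ℤ.+-inverseʳ
      ; ⁻¹-cong = λ {a} {b} (mod d) → mod (≡.subst (+ m ℤ.∣_) (neg-neg a b) (∣m⇒∣-m d))
      }
    ; comm = λ a b → reflexive (ℤ.+-comm a b)
    }
  }
  where
  reflexive : ∀ {a b} → a ≡ b → a ≡ b [mod m ]
  reflexive {a} ≡.refl = mod (divides 0ℤ (ℤ.+-inverseʳ a))

  neg-sub : ∀ a b → ℤ.- (a ℤ.- b) ≡ b ℤ.- a
  neg-sub = solve-∀

  sub-sub : ∀ a b c → (a ℤ.- b) ℤ.+ (b ℤ.- c) ≡ a ℤ.- c
  sub-sub = solve-∀

  sub-add : ∀ a a′ b b′ → (a ℤ.- a′) ℤ.+ (b ℤ.- b′) ≡ (a ℤ.+ b) ℤ.- (a′ ℤ.+ b′)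
  sub-add = solve-∀

  neg-neg : ∀ a b → ℤ.- (a ℤ.- b) ≡ (ℤ.- a) ℤ.- (ℤ.- b)
  neg-neg = solve-∀

Π-abelianGroup : {A : Set} → (A → AbelianGroup 0ℓ 0ℓ) → AbelianGroup 0ℓ 0ℓ
Π-abelianGroup {A} H = record
  { Carrier = ∀ i → H.Carrier i
  ; _≈_     = λ x y → ∀ i → H._≈_ i (x i) (y i)
  ; _∙_     = λ x y i → H._∙_ i (x i) (y i)
  ; ε       = λ i → H.ε i
  ; _⁻¹     = λ x i → H._⁻¹ i (x i)
  ; isAbelianGroup = record
    { isGroup = record
      { isMonoid = record
        { isSemigroup = record
          { isMagma = record
            { isEquivalence = record
              { refl  = λ i → H.refl i
              ; sym   = λ x≈y i → H.sym i (x≈y i)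
              ; trans = λ x≈y y≈z i → H.trans i (x≈y i) (y≈z i)
              }
            ; ∙-cong = λ x≈y u≈v i → H.∙-cong i (x≈y i) (u≈v i)
            }
          ; assoc = λ x y z i → H.assoc i (x i) (y i) (z i)
          }
        ; identity = (λ x i → H.identityˡ i (x i)) , (λ x i → H.identityʳ i (x i))
        }
      ; inverse = (λ x i → H.inverseˡ i (x i)) , (λ x i → H.inverseʳ i (x i))
      ; ⁻¹-cong = λ x≈y i → H.⁻¹-cong i (x≈y i)
      }
    ; comm = λ x y i → H.comm i (x i) (y i)
    }
  }
  where module H i = AbelianGroup (H i)

record FiniteAbelianGroup c ℓ : Set (lsuc (c ⊔ ℓ)) where
  field
    abelianGroup : AbelianGroup c ℓ

  open AbelianGroup abelianGroup public
    renaming (_∙_ to _⊕_; ε to 0#; _⁻¹ to ⊖_)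

  field
    order       : ℕ
    enumeration : Inverse setoid (≡.setoid (Fin order))

  open Inverse enumeration public
    using () renaming (to to index; from to element; to-cong to index-cong)

  open MonoidMult monoid public using () renaming (_×_ to _·_)

  element-index : ∀ x → element (index x) ≈ x
  element-index _ = Inverse.inverseʳ enumeration ≡.refl

  index-element : ∀ i → index (element i) ≡ i
  index-element _ = Inverse.inverseˡ enumeration refl

  infix 4 _≟_

  _≟_ : Decidable _≈_
  x ≟ y = map′ index-injective index-cong (index x Fin.≟ index y)
    where
    index-injective : index x ≡ index y → x ≈ y
    index-injective eq =
      trans (sym (element-index x)) (trans (reflexive (≡.cong element eq)) (element-index y))

  -- Some n with 1 ≤ n ≤ order annihilates g, so the search succeeds.
  ord : Carrier → ℕ
  ord g = suc (least (λ n → suc n · g ≟ 0#) order)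

  open CommutativeMonoidSum commutativeMonoid public using (sum)

  private
    module Sum = CommutativeMonoidSum commutativeMonoid

  order-annihilates : ∀ g → order · g ≈ 0#
  order-annihilates g = GroupProperties.identityʳ-unique group (sum element) (order · g) (sym (begin
    sum element                            ≈⟨ Sum.sum-permute element π ⟩
    sum (λ i → element (π ⟨$⟩ʳ i))         ≈⟨ Sum.sum-cong-≋ (λ i → element-index (element i ⊕ g)) ⟩
    sum (λ i → element i ⊕ g)              ≈⟨ Sum.∑-distrib-+ element (λ _ → g) ⟩
    sum element ⊕ sum {order} (λ _ → g)    ≈⟨ ∙-congˡ (Sum.sum-replicate order) ⟩
    sum element ⊕ order · g                ∎))
    where
    open SetoidReasoning setoid

    π : Permutation′ order
    π = permutation (λ i → index (element i ⊕ g)) (λ i → index (element i ⊕ ⊖ g))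
      (λ i → ≡.trans
        (index-cong (trans (∙-congʳ (element-index _)) (GroupProperties.//-rightDividesˡ group g (element i))))
        (index-element i))
      (λ i → ≡.trans
        (index-cong (trans (∙-congʳ (element-index _)) (GroupProperties.//-rightDividesʳ group g (element i))))
        (index-element i))

  ord-annihilates : ∀ g → ord g · g ≈ 0#
  ord-annihilates g = helper order ≡.refl
    where
    helper : ∀ N → order ≡ N → ord g · g ≈ 0#
    helper zero    eq = contradiction (≡.subst Fin eq (index 0#)) Fin.¬Fin0
    helper (suc N) eq = least-satisfies _ order
      (≡.subst (N ℕ.≤_) (≡.sym eq) (ℕ.n≤1+n N))
      (≡.subst (λ M → M · g ≈ 0#) eq (order-annihilates g))

  ord-minimal : ∀ g {n} → suc n ℕ.< ord g → ¬ suc n · g ≈ 0#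
  ord-minimal g 1+n< = least-minimal _ order (s<s⁻¹ 1+n<)

-- The data of a decomposition G = ⊕ᵢ ⊕ⱼ C (pᵢ ^ eᵢⱼ).
record PrimePowers : Set where
  field
    n          : ℕ
    p          : Fin n → ℕ
    p-prime    : ∀ i → Prime (p i)
    p-distinct : Injective _≡_ _≡_ p
    r          : Fin n → ℕ
    e          : ∀ i → Fin (r i) → ℕ
    e≥1        : ∀ i j → 1 ℕ.≤ e i j

⨁ : PrimePowers → AbelianGroup 0ℓ 0ℓ
⨁ D = Π-abelianGroup λ i → Π-abelianGroup λ j → C (p i ^ e i j)
  where open PrimePowers D

infix 4 _≅_

_≅_ : ∀ {a b c d} → AbelianGroup a b → AbelianGroup c d → Set (a ⊔ b ⊔ c ⊔ d)
G ≅ H = ∃[ f ] IsGroupIsomorphism f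
  where open GroupMorphisms (AbelianGroup.rawGroup G) (AbelianGroup.rawGroup H)

module _ {p e : ℕ} (pp : Prime p) (e≥1 : 1 ℕ.≤ e) where

  private
    instance
      p≢0 : NonZero p
      p≢0 = prime⇒nonZero pp

      pᵉ≢0 : NonZero (p ^ e)
      pᵉ≢0 = ℕ.m^n≢0 p e

      pᵉ-pᵉ⁻¹≢0 : NonZero (p ^ e ∸ p ^ (e ∸ 1))
      pᵉ-pᵉ⁻¹≢0 = ℕ.>-nonZero (ℕ.m<n⇒0<n∸m
        (ℕ.^-monoʳ-< p (ℕ.nonTrivial⇒n>1 p {{prime⇒nonTrivial pp}}) (ℕ.∸-monoʳ-< ℕ.z<s e≥1)))

  K₁*-cyclic : ℚ
  K₁*-cyclic = + (p ^ e ∸ 1) / (p ^ e ∸ p ^ (e ∸ 1))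

  k*-cyclic : ℚ
  k*-cyclic = + (p ^ e ∸ 1) / (p ^ e)

module _ (D : PrimePowers) where
  open PrimePowers D

  K₁* : ℚ
  K₁* = ∑[ i < n ] ∑[ j < r i ] K₁*-cyclic (p-prime i) (e≥1 i j)

  k* : ℚ
  k* = ∑[ i < n ] ∑[ j < r i ] k*-cyclic (p-prime i) (e≥1 i j)

  weightedK₁* : ℕ → ℚ
  weightedK₁* q = ∑[ i < n ] ∑[ j < r i ] (q÷p i * K₁*-cyclic (p-prime i) (e≥1 i j))
    where
    q÷p : Fin n → ℚ
    q÷p i = _/_ (+ q) (p i) {{prime⇒nonZero (p-prime i)}}

IsMaximum : ∀ {a} → Pred ℚ a → Pred ℚ a
IsMaximum P x = P x × (∀ {y} → P y → y ≤ x)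

-- An indexed multiset over G is a vector S of elements of G; its submultisets S(I)
-- are given by subsets I of the index set.
module _ {c ℓ} (G : FiniteAbelianGroup c ℓ) where
  open FiniteAbelianGroup G

  OverNonzero : ∀ {N} → Vector Carrier N → Set ℓ
  OverNonzero S = ∀ i → ¬ S i ≈ 0#

  module _ {N} (S : Vector Carrier N) where

    σ : Subset N → Carrier
    σ I = sum λ i → if lookup I i then S i else 0#

    ZeroSum : Subset N → Set ℓ
    ZeroSum I = σ I ≈ 0#

    MinimalZeroSum : Subset N → Set ℓ
    MinimalZeroSum I = ZeroSum I × (∀ J → Nonempty J → J ⊂ I → ¬ ZeroSum J)

    ZeroSumFree : Set ℓ
    ZeroSumFree = ∀ J → Nonempty J → ¬ ZeroSum J

    record IsIrreducibleFactorization {m} (I : Vector (Subset N) m) : Set ℓ where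
      field
        nonempty : ∀ i → Nonempty (I i)
        disjoint : ∀ {i j} → i ≢ j → Empty (I i ∩ I j)
        covers   : ∀ x → ∃[ i ] x ∈ I i
        minimal  : ∀ i → MinimalZeroSum (I i)

  SameBlocks : ∀ {N m m′} → Vector (Subset N) m → Vector (Subset N) m′ → Set
  SameBlocks I I′ = (∀ i → ∃[ j ] I i ≡ I′ j) × (∀ j → ∃[ i ] I i ≡ I′ j)

  record IsUFIM {N} (S : Vector Carrier N) : Set ℓ where
    field
      overNonzero : OverNonzero S
      zeroSum     : ZeroSum S ⊤
      exists      : ∃[ m ] Σ[ I ∈ Vector (Subset N) m ] IsIrreducibleFactorization S I
      unique      : ∀ {m m′} {I : Vector (Subset N) m} {I′ : Vector (Subset N) m′} →
                    IsIrreducibleFactorization S I → IsIrreducibleFactorization S I′ →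
                    SameBlocks I I′

  k : ∀ {N} → Vector Carrier N → ℚ
  k {N} S = ∑[ i < N ] (+ 1 / ord (S i))

  IsPGroup : ℕ → Set c
  IsPGroup p = ∀ g → ∃[ a ] ord g ≡ p ^ a

infix 4 k[_]≡_

-- The proposition k(G) = x: the maximum defining k(G) is attained and equals x.
k[_]≡_ : ∀ {c ℓ} → FiniteAbelianGroup c ℓ → ℚ → Set (c ⊔ ℓ)
k[ G ]≡ x = IsMaximum (λ y → ∃[ N ] Σ[ S ∈ Vector Carrier N ]
                OverNonzero G S × ZeroSumFree G S × k G S ≡ y) x
  where open FiniteAbelianGroup G

{-# OPTIONS --safe #-}
module Submission where

open import Defs
open import Algebra.Bundles using (AbelianGroup; CommutativeMonoid; CommutativeRing)
import Algebra.Construct.Pointwise as Pointwise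
import Algebra.Morphism.Construct.Composition as Composition
open import Algebra.Morphism.Structures using (module GroupMorphisms)
import Algebra.Properties.AbelianGroup as AbelianGroupProperties
import Algebra.Properties.CommutativeMonoid.Mult as CommutativeMonoidMult
import Algebra.Properties.CommutativeMonoid.Sum as CommutativeMonoidSum
import Algebra.Properties.CommutativeSemigroup as CommutativeSemigroupProperties
import Algebra.Properties.Semiring.Sum as SemiringSum
open import Data.Bool.Base using (if_then_else_)
open import Data.Bool.Properties using (∧-identityʳ)
open import Data.Fin.Base as Fin using (Fin; zero; suc; toℕ)
import Data.Fin.Properties as Fin
open import Data.Fin.Subset
  using (Subset; Nonempty; Empty; inside; outside; _∈_; _∉_; _⊆_; _⊂_; _∩_; _∪_; ∁; ⁅_⁆; ⊤; ∣_∣)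
  renaming (⊥ to ∅)
open import Data.Fin.Subset.Induction using (⊂-wellFounded; Acc; acc)
import Data.Fin.Subset.Properties as Subset
open import Data.Integer.Base as ℤ using (ℤ; +_; -[1+_]; 0ℤ; 1ℤ)
import Data.Integer.Divisibility.Signed as ℤ
import Data.Integer.Properties as ℤ
open import Data.List.Base as List using (List; []; _∷_)
open import Data.List.Membership.Propositional using () renaming (_∈_ to _∈ˡ_)
open import Data.List.Membership.Propositional.Properties using (∈-tabulate⁺; ∈-concat⁺′)
open import Data.List.Relation.Unary.Any using (here; there)
open import Data.Nat.Base as ℕ using (ℕ; zero; suc; _∸_; _^_; _!; NonZero; z≤n; s≤s)
open import Data.Nat.Combinatorics
  using (nCk≡n!/k![n-k]!; k![n∸k]!∣n!; k>n⇒nCk≡0; nCk+nC[k+1]≡[n+1]C[k+1]; nCn≡1)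
  renaming (_C_ to _choose_)
open import Data.Nat.DivMod using (m/n*n≡m; m≡m%n+[m/n]*n; m%n<n)
open import Data.Nat.Divisibility as ℕ using (_∣_; divides)
open import Data.Nat.Primality
  using (Prime; euclidsLemma; prime⇒irreducible; prime⇒nonZero; prime⇒nonTrivial)
import Data.Nat.Properties as ℕ
open import Data.Nat.Tactic.RingSolver using (solve-∀)
open import Data.Product.Base using (∃-syntax; Σ; Σ-syntax; _×_; _,_; proj₁; proj₂)
open import Data.Rational.Base as ℚ using (ℚ; _/_; _≤_; toℚᵘ)
import Data.Rational.Properties as ℚ
open import Data.Rational.Unnormalised.Base as ℚᵘ using (mkℚᵘ; *≡*; *≤*)
import Data.Rational.Unnormalised.Properties as ℚᵘ
open import Data.Sum.Base using (inj₁; inj₂)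
open import Data.Vec.Base using ([]; _∷_; here; there)
open import Data.Vec.Functional using (Vector)
open import Function.Base using (_∘_; id)
open import Level using (Level; _⊔_; 0ℓ)
open import Relation.Binary.PropositionalEquality as ≡ using (_≡_; _≢_)
import Relation.Binary.Reasoning.Setoid as SetoidReasoning
open import Relation.Nullary.Decidable using (does; yes; no; _×-dec_)
open import Relation.Nullary.Negation using (¬_; contradiction)
open import Relation.Unary using (Pred)

-- Deleting one element from every block of a UFIM leaves a zero-sum free family, of cross number at
-- most k*(G), while the m deleted elements contribute at most m/q if every nonzero element has order
-- at least q. Since k*(C) + K₁*(C)/p = K₁*(C) for a cyclic group C of order pᵉ, the bound on m gives
-- k(S) ≤ K₁*(G).
--
-- For p-groups, k(S) ≤ k*(G) for zero-sum free S is a weighted form of Olson's group ring argument,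
-- with functions G → ℤ/p in place of the group ring. Let T_g be translation by g and Δ g = T_g - 1.
-- By Frobenius, Δ (pˢ g) = (Δ g)^(pˢ); so if the generator of a summand of order pᵉ gets weight
-- p^(h-e), then Δ g has weight at least p^(h-k) for g of order pᵏ. Monomials in the Δ of the generators
-- vanish beyond weight ∑ (pᵉ - 1) p^(h-e) = pʰ k*(G), whereas the product of the Δ g over a zero-sum
-- free S, of weight at least pʰ k(S), does not kill the indicator function of 0.

open CommutativeMonoidSum ℕ.+-0-commutativeMonoid using () renaming (sum to ∑ℕ)

private
  variable
    a b c ℓ ℓ₁ ℓ₂ : Level
    N : ℕ

-- Binomial coefficients modulo p

prime∤! : ∀ {p} → Prime p → ∀ {n} → n ℕ.< p → ¬ p ∣ n !
prime∤! pp {zero}  _   p∣1 = contradiction (ℕ.∣1⇒≡1 p∣1) (ℕ.nonTrivial⇒≢1 {{prime⇒nonTrivial pp}})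
prime∤! pp {suc n} n<p p∣n! with euclidsLemma (suc n) (n !) pp p∣n!
... | inj₁ p∣1+n = ℕ.>⇒∤ n<p p∣1+n
... | inj₂ p∣n!′ = prime∤! pp (ℕ.<-trans (ℕ.n<1+n n) n<p) p∣n!′

-- Since p divides p!, which is the binomial coefficient times k! (p - k)!, and both factorials have
-- only factors below p, Euclid's lemma leaves the coefficient.
prime∣C : ∀ {p} → Prime p → ∀ {k} → 0 ℕ.< k → k ℕ.< p → p ∣ p choose k
prime∣C {p} pp {k} 0<k k<p with euclidsLemma (p choose k) (k ! ℕ.* (p ∸ k) !) pp p∣C*
  where
  instance _ = ℕ._!*_!≢0 k (p ∸ k)

  n∣n! : ∀ n .{{_ : NonZero n}} → n ∣ n !
  n∣n! (suc n) = ℕ.m∣m*n (n !)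

  p∣C* : p ∣ (p choose k) ℕ.* (k ! ℕ.* (p ∸ k) !)
  p∣C* = ≡.subst (p ∣_)
    (≡.sym (≡.trans (≡.cong (ℕ._* (k ! ℕ.* (p ∸ k) !)) (nCk≡n!/k![n-k]! (ℕ.<⇒≤ k<p))) (m/n*n≡m (k![n∸k]!∣n! (ℕ.<⇒≤ k<p)))))
    (n∣n! p {{prime⇒nonZero pp}})
... | inj₁ p∣C = p∣C
... | inj₂ p∣k!j! with euclidsLemma (k !) ((p ∸ k) !) pp p∣k!j!
...   | inj₁ p∣k! = contradiction p∣k! (prime∤! pp k<p)
...   | inj₂ p∣j! = contradiction p∣j! (prime∤! pp (ℕ.∸-monoʳ-< 0<k (ℕ.<⇒≤ k<p)))

-- Homomorphisms and subgroups

module _ (M : CommutativeMonoid a ℓ₁) where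
  open CommutativeMonoid M
  open CommutativeMonoidMult M using () renaming (_×_ to _×ᴹ_)

  ×-ε : ∀ n → n ×ᴹ ε ≈ ε
  ×-ε zero    = refl
  ×-ε (suc n) = trans (identityˡ _) (×-ε n)

infix 4 _⟶_

_⟶_ : AbelianGroup a ℓ₁ → AbelianGroup b ℓ₂ → Set _
G ⟶ H = ∃[ f ] IsGroupHomomorphism f
  where open GroupMorphisms (AbelianGroup.rawGroup G) (AbelianGroup.rawGroup H)

-- Between groups, additivity already forces preservation of the identity and of inverses, by
-- cancellation.
mkHom : (G : AbelianGroup a ℓ₁) (H : AbelianGroup b ℓ₂) →
  let module G = AbelianGroup G; module H = AbelianGroup H in
  (f : G.Carrier → H.Carrier) → (∀ {x y} → x G.≈ y → f x H.≈ f y) →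
  (∀ x y → f (x G.∙ y) H.≈ f x H.∙ f y) → G ⟶ H
mkHom G H f f-cong f-∙ = f , record
  { isMonoidHomomorphism = record
    { isMagmaHomomorphism = record { isRelHomomorphism = record { cong = f-cong } ; homo = f-∙ }
    ; ε-homo = f-ε
    }
  ; ⁻¹-homo = λ x → inverseʳ-unique (f x) (f (x G.⁻¹))
      (H.trans (H.sym (f-∙ x _)) (H.trans (f-cong (G.inverseʳ x)) f-ε))
  }
  where
  module G = AbelianGroup G
  module H = AbelianGroup H
  open AbelianGroupProperties H using (inverseʳ-unique; identityʳ-unique)

  f-ε : f G.ε H.≈ H.ε
  f-ε = identityʳ-unique _ _ (H.trans (H.sym (f-∙ G.ε G.ε)) (f-cong (G.identityˡ G.ε)))

module Hom (G : AbelianGroup a ℓ₁) (H : AbelianGroup b ℓ₂) (hom : G ⟶ H) where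
  private
    module G = AbelianGroup G
    module H = AbelianGroup H
    module G× = CommutativeMonoidMult G.commutativeMonoid
    module H× = CommutativeMonoidMult H.commutativeMonoid

  f = proj₁ hom
  open GroupMorphisms G.rawGroup H.rawGroup
  open IsGroupHomomorphism (proj₂ hom) public

  ×-homo : ∀ n x → f (n G×.× x) H.≈ n H×.× f x
  ×-homo zero    x = ε-homo
  ×-homo (suc n) x = H.trans (homo x _) (H.∙-congˡ (×-homo n x))

compose : ∀ {c ℓ₃} (G : AbelianGroup a ℓ₁) (H : AbelianGroup b ℓ₂) (K : AbelianGroup c ℓ₃) → G ⟶ H → H ⟶ K → G ⟶ K
compose G H K (f , f-hom) (g , g-hom) = g ∘ f , Composition.isGroupHomomorphism (AbelianGroup.trans K) f-hom g-hom

-- Serves to extend a property from generators to all elements; the main instance is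
-- `lowers-isSubgroup`. Over setoids, membership must also respect the equality.
record IsSubgroup (G : AbelianGroup a ℓ₁) (P : Pred (AbelianGroup.Carrier G) ℓ) : Set (a ⊔ ℓ₁ ⊔ ℓ) where
  open AbelianGroup G
  field
    resp      : ∀ {x y} → x ≈ y → P x → P y
    ε-closed  : P ε
    ∙-closed  : ∀ {x y} → P x → P y → P (x ∙ y)
    ⁻¹-closed : ∀ {x} → P x → P (x ⁻¹)

preimage : (G : AbelianGroup a ℓ₁) (H : AbelianGroup b ℓ₂) (f : G ⟶ H) {P : Pred (AbelianGroup.Carrier H) ℓ} →
           IsSubgroup H P → IsSubgroup G (P ∘ proj₁ f)
preimage G H f sub = record
  { resp = S.resp ∘ ⟦⟧-cong
  ; ε-closed = S.resp (H.sym ε-homo) S.ε-closed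
  ; ∙-closed = λ p q → S.resp (H.sym (homo _ _)) (S.∙-closed p q)
  ; ⁻¹-closed = λ p → S.resp (H.sym (⁻¹-homo _)) (S.⁻¹-closed p)
  }
  where
  module S = IsSubgroup sub
  module H = AbelianGroup H
  open Hom G H f

-- Difference operators of a group action

module _ {J : Set} (t : J → ℕ) where

  weightOf : List J → ℕ
  weightOf = List.foldr (λ j d → t j ℕ.+ d) 0

  weightOf-++ : ∀ xs ys → weightOf (xs List.++ ys) ≡ weightOf xs ℕ.+ weightOf ys
  weightOf-++ []       ys = ≡.refl
  weightOf-++ (x ∷ xs) ys = ≡.trans (≡.cong (t x ℕ.+_) (weightOf-++ xs ys)) (≡.sym (ℕ.+-assoc (t x) _ _))

  weightOf-tabulate : ∀ {n} (f : Fin n → J) → weightOf (List.tabulate f) ≡ ∑ℕ (t ∘ f)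
  weightOf-tabulate {zero}  f = ≡.refl
  weightOf-tabulate {suc n} f = ≡.cong (t (f zero) ℕ.+_) (weightOf-tabulate (f ∘ suc))

  weightOf-concat : ∀ {n} (F : Fin n → List J) → weightOf (List.concat (List.tabulate F)) ≡ ∑ℕ (weightOf ∘ F)
  weightOf-concat {zero}  F = ≡.refl
  weightOf-concat {suc n} F = ≡.trans (weightOf-++ (F zero) _) (≡.cong (weightOf (F zero) ℕ.+_) (weightOf-concat (F ∘ suc)))

-- A module over the integral group ring of `𝔾`, given by the action of the group elements alone, so
-- that the ring itself is never built.
record Action (𝔾 : AbelianGroup a ℓ₁) (𝕄 : AbelianGroup b ℓ₂) : Set (a ⊔ b ⊔ ℓ₁ ⊔ ℓ₂) where
  private
    module G = AbelianGroup 𝔾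
    module M = AbelianGroup 𝕄

  infixr 7.5 _▷_

  field
    _▷_    : G.Carrier → M.Carrier → M.Carrier
    ▷-cong : ∀ {g h x y} → g G.≈ h → x M.≈ y → g ▷ x M.≈ h ▷ y
    ▷-+    : ∀ g x y → g ▷ (x M.∙ y) M.≈ (g ▷ x) M.∙ (g ▷ y)
    ▷-∙    : ∀ g h x → (g G.∙ h) ▷ x M.≈ g ▷ h ▷ x
    ▷-ε    : ∀ x → G.ε ▷ x M.≈ x

module Differences {𝔾 : AbelianGroup a ℓ₁} {𝕄 : AbelianGroup b ℓ₂} (act : Action 𝔾 𝕄) where

  open Action act

  private
    module G where
      open AbelianGroup 𝔾 public
      open CommutativeMonoidMult commutativeMonoid public
    module MProps = AbelianGroupProperties 𝕄

  open AbelianGroup 𝕄 renaming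
    ( _∙_ to _+_; ε to 0#; _⁻¹ to -_; ∙-cong to +-cong; ∙-congˡ to +-congˡ; ∙-congʳ to +-congʳ
    ; identityˡ to +-identityˡ; identityʳ to +-identityʳ; inverseʳ to -‿inverseʳ; comm to +-comm; assoc to +-assoc
    ; ⁻¹-cong to -‿cong )
  open CommutativeMonoidMult commutativeMonoid using (×-congʳ; ×-congˡ; ×-homo-+; ×-homo-1; ×-assocˡ) renaming (_×_ to _×ᴹ_)
  open CommutativeMonoidSum commutativeMonoid using (sum; sum-cong-≋; ∑-distrib-+; sum-init-last; sum-replicate-zero)
  open CommutativeSemigroupProperties commutativeSemigroup using (interchange)
  open SetoidReasoning setoid

  ▷-congˡ : ∀ g {x y} → x ≈ y → g ▷ x ≈ g ▷ y
  ▷-congˡ g = ▷-cong G.refl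

  ▷-0 : ∀ g → g ▷ 0# ≈ 0#
  ▷-0 g = MProps.identityʳ-unique (g ▷ 0#) (g ▷ 0#) (trans (sym (▷-+ g 0# 0#)) (▷-congˡ g (+-identityˡ 0#)))

  ▷-neg : ∀ g x → g ▷ (- x) ≈ - (g ▷ x)
  ▷-neg g x = MProps.inverseʳ-unique (g ▷ x) (g ▷ (- x))
    (trans (sym (▷-+ g x (- x))) (trans (▷-congˡ g (-‿inverseʳ x)) (▷-0 g)))

  ▷-comm : ∀ g h x → g ▷ h ▷ x ≈ h ▷ g ▷ x
  ▷-comm g h x = trans (sym (▷-∙ g h x)) (trans (▷-cong (G.comm g h) refl) (▷-∙ h g x))

  Δ : G.Carrier → Carrier → Carrier
  Δ g x = (g ▷ x) + (- x)

  Δ-cong : ∀ {g h x y} → g G.≈ h → x ≈ y → Δ g x ≈ Δ h y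
  Δ-cong g≈h x≈y = +-cong (▷-cong g≈h x≈y) (-‿cong x≈y)

  Δ-+ : ∀ g x y → Δ g (x + y) ≈ Δ g x + Δ g y
  Δ-+ g x y = trans (+-cong (▷-+ g x y) (sym (MProps.⁻¹-∙-comm x y))) (interchange _ _ _ _)

  Δ-0 : ∀ g → Δ g 0# ≈ 0#
  Δ-0 g = trans (+-congʳ (▷-0 g)) (-‿inverseʳ 0#)

  Δ-ε : ∀ x → Δ G.ε x ≈ 0#
  Δ-ε x = trans (+-congʳ (▷-ε x)) (-‿inverseʳ x)

  ▷-via-Δ : ∀ g x → g ▷ x ≈ x + Δ g x
  ▷-via-Δ g x = sym (trans (sym (+-assoc x _ _)) (MProps.xyx⁻¹≈y x (g ▷ x)))

  -- The properties by which translations, negation and the operators `Δ g` all preserve the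
  -- filtration `V` defined below.
  record Equivariant (F : Carrier → Carrier) : Set (a ⊔ b ⊔ ℓ₂) where
    field
      cong      : ∀ {x y} → x ≈ y → F x ≈ F y
      zero↦     : F 0# ≈ 0#
      Δ-commute : ∀ g x → F (Δ g x) ≈ Δ g (F x)

  ▷-equivariant : ∀ g → Equivariant (g ▷_)
  ▷-equivariant g = record
    { cong = ▷-congˡ g
    ; zero↦ = ▷-0 g
    ; Δ-commute = λ h x → trans (▷-+ g _ _) (+-cong (▷-comm g h x) (▷-neg g x))
    }

  neg-equivariant : Equivariant (-_)
  neg-equivariant = record
    { cong = -‿cong
    ; zero↦ = MProps.ε⁻¹≈ε
    ; Δ-commute = λ g x → trans (sym (MProps.⁻¹-∙-comm _ _)) (+-congʳ (sym (▷-neg g x)))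
    }

  Δ-equivariant : ∀ g → Equivariant (Δ g)
  Δ-equivariant g = record
    { cong = Δ-cong G.refl
    ; zero↦ = Δ-0 g
    ; Δ-commute = λ h x → begin
        Δ g (Δ h x)                       ≈⟨ Δ-+ g _ _ ⟩
        Δ g (h ▷ x) + Δ g (- x)           ≈⟨ +-cong (sym (h▷.Δ-commute g x)) (sym (neg.Δ-commute g x)) ⟩
        Δ h (Δ g x)                       ∎
    }
    where
    module neg = Equivariant neg-equivariant
    module h▷ {h} = Equivariant (▷-equivariant h)

  Δ^ : ℕ → G.Carrier → Carrier → Carrier
  Δ^ zero    g x = x
  Δ^ (suc i) g x = Δ^ i g (Δ g x)

  Δ^-cong : ∀ i {g h x y} → g G.≈ h → x ≈ y → Δ^ i g x ≈ Δ^ i h y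
  Δ^-cong zero    g≈h x≈y = x≈y
  Δ^-cong (suc i) g≈h x≈y = Δ^-cong i g≈h (Δ-cong g≈h x≈y)

  equivariant-Δ^ : ∀ {F} → Equivariant F → ∀ i g x → F (Δ^ i g x) ≈ Δ^ i g (F x)
  equivariant-Δ^ F zero    g x = refl
  equivariant-Δ^ F (suc i) g x = trans (equivariant-Δ^ F i g (Δ g x)) (Δ^-cong i G.refl (Equivariant.Δ-commute F g x))

  Δ^-+ : ∀ i g x y → Δ^ i g (x + y) ≈ Δ^ i g x + Δ^ i g y
  Δ^-+ zero    g x y = refl
  Δ^-+ (suc i) g x y = trans (Δ^-cong i G.refl (Δ-+ g x y)) (Δ^-+ i g _ _)

  Δ^-0 : ∀ i g → Δ^ i g 0# ≈ 0#
  Δ^-0 zero    g = refl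
  Δ^-0 (suc i) g = trans (Δ^-cong i G.refl (Δ-0 g)) (Δ^-0 i g)

  Δ^-homo-+ : ∀ i j g x → Δ^ (i ℕ.+ j) g x ≈ Δ^ j g (Δ^ i g x)
  Δ^-homo-+ zero    j g x = refl
  Δ^-homo-+ (suc i) j g x = Δ^-homo-+ i j g (Δ g x)

  multiple-▷ : ∀ n g x → (suc n G.× g) ▷ x ≈ (n G.× g) ▷ x + (n G.× g) ▷ Δ g x
  multiple-▷ n g x = begin
    (g G.∙ n G.× g) ▷ x                 ≈⟨ ▷-cong (G.comm g _) refl ⟩
    (n G.× g G.∙ g) ▷ x                 ≈⟨ ▷-∙ _ g x ⟩
    (n G.× g) ▷ g ▷ x                   ≈⟨ ▷-congˡ _ (▷-via-Δ g x) ⟩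
    (n G.× g) ▷ (x + Δ g x)             ≈⟨ ▷-+ _ x _ ⟩
    (n G.× g) ▷ x + (n G.× g) ▷ Δ g x   ∎

  -- Any upper summation limit beyond n will do; its freedom lets the induction
  -- follow Pascal's rule without splitting off last terms.
  binomial : ∀ n N → n ℕ.< N → ∀ g x →
    (n G.× g) ▷ x ≈ sum {N} (λ i → (n choose toℕ i) ×ᴹ Δ^ (toℕ i) g x)
  binomial zero (suc N) _ g x = begin
    G.ε ▷ x       ≈⟨ ▷-ε x ⟩
    x             ≈⟨ ×-homo-1 x ⟨
    1 ×ᴹ x        ≈⟨ +-identityʳ _ ⟨
    1 ×ᴹ x + 0#   ≈⟨ +-congˡ (trans (sum-cong-≋ {N} (λ i →
                       ×-congˡ {Δ^ (suc (toℕ i)) g x} (k>n⇒nCk≡0 {0} {suc (toℕ i)} (s≤s z≤n))))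
                       (sum-replicate-zero N)) ⟨
    1 ×ᴹ x + sum {N} (λ i → (0 choose suc (toℕ i)) ×ᴹ Δ^ (suc (toℕ i)) g x) ∎
  binomial (suc n) (suc N) (s≤s n<N) g x = begin
    (suc n G.× g) ▷ x
      ≈⟨ multiple-▷ n g x ⟩
    (n G.× g) ▷ x + (n G.× g) ▷ Δ g x
      ≈⟨ +-cong (binomial n (suc N) (ℕ.m<n⇒m<1+n n<N) g x) (binomial n N n<N g (Δ g x)) ⟩
    (1 ×ᴹ x + sum {N} upper) + sum {N} lower
      ≈⟨ +-assoc _ _ _ ⟩
    1 ×ᴹ x + (sum {N} upper + sum {N} lower)
      ≈⟨ +-congˡ (∑-distrib-+ {N} upper lower) ⟨
    1 ×ᴹ x + sum {N} (λ i → upper i + lower i)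
      ≈⟨ +-congˡ (sum-cong-≋ {N} pascal) ⟩
    1 ×ᴹ x + sum {N} (λ i → (suc n choose suc (toℕ i)) ×ᴹ Δ^ (suc (toℕ i)) g x) ∎
    where
    upper lower : Vector Carrier N
    upper i = (n choose suc (toℕ i)) ×ᴹ Δ^ (suc (toℕ i)) g x
    lower i = (n choose toℕ i) ×ᴹ Δ^ (suc (toℕ i)) g x

    pascal : ∀ i → upper i + lower i ≈ (suc n choose suc (toℕ i)) ×ᴹ Δ^ (suc (toℕ i)) g x
    pascal i = trans (+-comm _ _) (trans (sym (×-homo-+ _ (n choose toℕ i) _))
      (×-congˡ (nCk+nC[k+1]≡[n+1]C[k+1] n (toℕ i))))

  module Characteristic {p} (pp : Prime p) (p×x≈0 : ∀ x → p ×ᴹ x ≈ 0#) where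

    p∣⇒×≈0 : ∀ {n} → p ∣ n → ∀ x → n ×ᴹ x ≈ 0#
    p∣⇒×≈0 (divides k ≡.refl) x = trans (sym (×-assocˡ x k p)) (trans (×-congʳ k (p×x≈0 x)) (×-ε commutativeMonoid k))

    -- Translation by p g is (1 + Δ g)^p. Its interior binomial coefficients are divisible by p and
    -- act as zero, and its constant term cancels against - x.
    frobenius-p : ∀ g x → Δ (p G.× g) x ≈ Δ^ p g x
    frobenius-p g x = aux p ≡.refl
      where
      -- Matching on `n` exposes p as a successor, so that the first and the last term of the
      -- binomial sum can be split off.
      aux : ∀ n → n ≡ p → Δ (n G.× g) x ≈ Δ^ n g x
      aux zero    eq = contradiction (≡.sym eq) (ℕ.≢-nonZero⁻¹ p {{prime⇒nonZero pp}})
      aux (suc n) eq = begin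
        (suc n G.× g) ▷ x + (- x)                       ≈⟨ +-congʳ (binomial (suc n) (suc (suc n)) (ℕ.n<1+n _) g x) ⟩
        (1 ×ᴹ x + sum {suc n} t) + (- x)                ≈⟨ +-congʳ (+-cong (×-homo-1 x) (sum-init-last t)) ⟩
        (x + (sum {n} (λ i → t (Fin.inject₁ i)) + t (Fin.fromℕ n))) + (- x)
          ≈⟨ MProps.xyx⁻¹≈y x _ ⟩
        sum {n} (λ i → t (Fin.inject₁ i)) + t (Fin.fromℕ n)
          ≈⟨ +-cong (trans (sum-cong-≋ {n} middle) (sum-replicate-zero n)) top ⟩
        0# + Δ^ (suc n) g x                             ≈⟨ +-identityˡ _ ⟩
        Δ^ (suc n) g x                                  ∎
        where
        t : Vector Carrier (suc n)
        t i = (suc n choose suc (toℕ i)) ×ᴹ Δ^ (suc (toℕ i)) g x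

        middle : ∀ i → t (Fin.inject₁ i) ≈ 0#
        middle i rewrite Fin.toℕ-inject₁ i = p∣⇒×≈0
          (≡.subst (λ q → q ∣ suc n choose suc (toℕ i)) eq
            (prime∣C (≡.subst Prime (≡.sym eq) pp) ℕ.z<s (ℕ.s<s (Fin.toℕ<n i)))) _

        top : t (Fin.fromℕ n) ≈ Δ^ (suc n) g x
        top rewrite Fin.toℕ-fromℕ n | nCn≡1 (suc n) = ×-homo-1 _

    frobenius : ∀ s g x → Δ ((p ^ s) G.× g) x ≈ Δ^ (p ^ s) g x
    frobenius zero    g x = Δ-cong (G.×-homo-1 g) refl
    frobenius (suc s) g x = begin
      Δ ((p ^ suc s) G.× g) x          ≈⟨ Δ-cong (G.×-assocˡ g p (p ^ s)) refl ⟨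
      Δ (p G.× ((p ^ s) G.× g)) x      ≈⟨ frobenius-p _ x ⟩
      Δ^ p ((p ^ s) G.× g) x           ≈⟨ iterate p x ⟩
      Δ^ (p ^ suc s) g x               ∎
      where
      iterate : ∀ k y → Δ^ k ((p ^ s) G.× g) y ≈ Δ^ (k ℕ.* p ^ s) g y
      iterate zero    y = refl
      iterate (suc k) y = begin
        Δ^ k ((p ^ s) G.× g) (Δ ((p ^ s) G.× g) y)  ≈⟨ Δ^-cong k G.refl (frobenius s g y) ⟩
        Δ^ k ((p ^ s) G.× g) (Δ^ (p ^ s) g y)       ≈⟨ iterate k _ ⟩
        Δ^ (k ℕ.* p ^ s) g (Δ^ (p ^ s) g y)         ≈⟨ Δ^-homo-+ (p ^ s) (k ℕ.* p ^ s) g y ⟨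
        Δ^ (p ^ s ℕ.+ k ℕ.* p ^ s) g y              ∎

  -- V js d x says that every monomial ∏ⱼ Δ (u j) ^ iⱼ over js of weighted degree ∑ⱼ iⱼ * w j ≥ d
  -- annihilates x.
  module Filtration {J : Set} (u : J → G.Carrier) (w : J → ℕ) where

    V : List J → ℕ → Carrier → Set ℓ₂
    V []       d x = d ≡ 0 → x ≈ 0#
    V (j ∷ js) d x = ∀ i → V js (d ∸ i ℕ.* w j) (Δ^ i (u j) x)

    V-cong : ∀ js {d x y} → x ≈ y → V js d x → V js d y
    V-cong []       x≈y v d≡0 = trans (sym x≈y) (v d≡0)
    V-cong (j ∷ js) x≈y v i   = V-cong js (Δ^-cong i G.refl x≈y) (v i)

    V-0 : ∀ js {d} → V js d 0#
    V-0 []       _ = refl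
    V-0 (j ∷ js) i = V-cong js (sym (Δ^-0 i (u j))) (V-0 js)

    V-+ : ∀ js {d x y} → V js d x → V js d y → V js d (x + y)
    V-+ []       v v′ d≡0 = trans (+-cong (v d≡0) (v′ d≡0)) (+-identityˡ 0#)
    V-+ (j ∷ js) v v′ i   = V-cong js (sym (Δ^-+ i (u j) _ _)) (V-+ js (v i) (v′ i))

    V-equivariant : ∀ js {F} → Equivariant F → ∀ {d x} → V js d x → V js d (F x)
    V-equivariant []       F v d≡0 = trans (Equivariant.cong F (v d≡0)) (Equivariant.zero↦ F)
    V-equivariant (j ∷ js) F v i   = V-cong js (equivariant-Δ^ F i (u j) _) (V-equivariant js F (v i))

    V-mono : ∀ js {d e x} → d ℕ.≤ e → V js d x → V js e x
    V-mono []       d≤e v e≡0 = v (ℕ.n≤0⇒n≡0 (≡.subst (_ ℕ.≤_) e≡0 d≤e))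
    V-mono (j ∷ js) d≤e v i   = V-mono js (ℕ.∸-monoˡ-≤ (i ℕ.* w j) d≤e) (v i)

    -- The empty monomial has degree 0 and acts as the identity.
    V₀⇒≈0 : ∀ js {x} → V js 0 x → x ≈ 0#
    V₀⇒≈0 []       v = v ≡.refl
    V₀⇒≈0 (j ∷ js) v = V₀⇒≈0 js (v 0)

    -- Precomposing a monomial with `Δ (u j)` raises the exponent of j by one, hence its degree by
    -- `w j`; commutativity moves the factor to its place.
    V-Δ : ∀ js {j} → j ∈ˡ js → ∀ {d x} → V js d x → V js (d ∸ w j) (Δ (u j) x)
    V-Δ (j ∷ js) (here ≡.refl) {d} {x} v i =
      ≡.subst (λ e → V js e (Δ^ (suc i) (u j) x)) (≡.sym (ℕ.∸-+-assoc d (w j) (i ℕ.* w j))) (v (suc i))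
    V-Δ (k ∷ js) {j} (there j∈) {d} {x} v i =
      ≡.subst (λ e → V js e (Δ^ i (u k) (Δ (u j) x)))
        (≡.trans (ℕ.∸-+-assoc d (i ℕ.* w k) (w j))
          (≡.trans (≡.cong (d ∸_) (ℕ.+-comm (i ℕ.* w k) (w j))) (≡.sym (ℕ.∸-+-assoc d (w j) (i ℕ.* w k)))))
        (V-cong js (equivariant-Δ^ (Δ-equivariant (u j)) i (u k) x) (V-Δ js j∈ (v i)))

    V-Δ^ : ∀ js {j} → j ∈ˡ js → ∀ n {d x} → V js d x → V js (d ∸ n ℕ.* w j) (Δ^ n (u j) x)
    V-Δ^ js j∈ zero    v = v
    V-Δ^ js {j} j∈ (suc n) {d} {x} v =
      ≡.subst (λ e → V js e (Δ^ (suc n) (u j) x)) (ℕ.∸-+-assoc d (w j) (n ℕ.* w j)) (V-Δ^ js j∈ n (V-Δ js j∈ v))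

    module _ (q : J → ℕ) where

      degree : List J → ℕ
      degree = weightOf λ j → ℕ.pred (q j) ℕ.* w j

      -- A monomial with some exponent at least `q j` acts as zero, and with all exponents at most
      -- `q j - 1` the degree cannot exceed `degree js`. This is where the filtration argument
      -- starts, for an arbitrary x.
      V-degree : (∀ j x → Δ^ (q j) (u j) x ≈ 0#) → ∀ js x → V js (suc (degree js)) x
      V-degree Δ^q≈0 []       x ()
      V-degree Δ^q≈0 (j ∷ js) x i with ℕ.<-≤-connex i (q j)
      ... | inj₁ i<q = V-mono js bound (V-degree Δ^q≈0 js _)
        where
        bound : suc (degree js) ℕ.≤ suc (ℕ.pred (q j) ℕ.* w j ℕ.+ degree js) ∸ i ℕ.* w j
        bound = ℕ.m+n≤o⇒m≤o∸n (suc (degree js)) (s≤s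
          (≡.subst (ℕ._≤ ℕ.pred (q j) ℕ.* w j ℕ.+ degree js) (ℕ.+-comm (i ℕ.* w j) (degree js))
            (ℕ.+-monoˡ-≤ (degree js) (ℕ.*-monoˡ-≤ (w j) (ℕ.<⇒≤pred i<q)))))
      ... | inj₂ q≤i = V-cong js (sym vanish) (V-0 js)
        where
        vanish : Δ^ i (u j) x ≈ 0#
        vanish = begin
          Δ^ i (u j) x                                   ≡⟨ ≡.cong (λ k → Δ^ k (u j) x) (ℕ.m+[n∸m]≡n q≤i) ⟨
          Δ^ (q j ℕ.+ (i ∸ q j)) (u j) x                 ≈⟨ Δ^-homo-+ (q j) (i ∸ q j) (u j) x ⟩
          Δ^ (i ∸ q j) (u j) (Δ^ (q j) (u j) x)          ≈⟨ Δ^-cong (i ∸ q j) G.refl (Δ^q≈0 j x) ⟩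
          Δ^ (i ∸ q j) (u j) 0#                          ≈⟨ Δ^-0 (i ∸ q j) (u j) ⟩
          0#                                             ∎

    module _ (js : List J) where

      -- Expresses that `Δ g` has weight at least c, through its effect on the filtration.
      Lowers : ℕ → G.Carrier → Set (b ⊔ ℓ₂)
      Lowers c g = ∀ {d x} → V js d x → V js (d ∸ c) (Δ g x)

      lowers-cong : ∀ {c g h} → g G.≈ h → Lowers c g → Lowers c h
      lowers-cong g≈h l v = V-cong js (Δ-cong g≈h refl) (l v)

      lowers-ε : ∀ {c} → Lowers c G.ε
      lowers-ε v = V-cong js (sym (Δ-ε _)) (V-0 js)

      -- By the cocycle identity, `Δ` of a product is `Δ h` translated by g, plus `Δ g`; translation
      -- preserves the filtration.
      lowers-∙ : ∀ {c g h} → Lowers c g → Lowers c h → Lowers c (g G.∙ h)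
      lowers-∙ {c} {g} {h} l l′ {d} {x} v = V-cong js cocycle (V-+ js (V-equivariant js (▷-equivariant g) (l′ v)) (l v))
        where
        cocycle : g ▷ Δ h x + Δ g x ≈ Δ (g G.∙ h) x
        cocycle = begin
          g ▷ Δ h x + Δ g x                         ≈⟨ +-assoc _ _ _ ⟨
          (g ▷ Δ h x + g ▷ x) + (- x)               ≈⟨ +-congʳ (▷-+ g _ _) ⟨
          g ▷ (Δ h x + x) + (- x)                   ≈⟨ +-congʳ (▷-congˡ g (trans (+-comm _ x) (sym (▷-via-Δ h x)))) ⟩
          g ▷ h ▷ x + (- x)                         ≈⟨ +-congʳ (▷-∙ g h x) ⟨
          Δ (g G.∙ h) x                             ∎

      -- `Δ` of the inverse of g is minus `Δ g` after translation by that inverse.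
      lowers-⁻¹ : ∀ {c g} → Lowers c g → Lowers c (g G.⁻¹)
      lowers-⁻¹ {c} {g} l {d} {x} v =
        V-cong js negated (V-equivariant js neg-equivariant (l (V-equivariant js (▷-equivariant (g G.⁻¹)) v)))
        where
        negated : - Δ g (g G.⁻¹ ▷ x) ≈ Δ (g G.⁻¹) x
        negated = begin
          - (g ▷ g G.⁻¹ ▷ x + - (g G.⁻¹ ▷ x))  ≈⟨ MProps.⁻¹-anti-homo‿- _ _ ⟩
          g G.⁻¹ ▷ x + - (g ▷ g G.⁻¹ ▷ x)      ≈⟨ +-congˡ (-‿cong (trans (sym (▷-∙ g _ x))
                                                    (trans (▷-cong (G.inverseʳ g) refl) (▷-ε x)))) ⟩
          g G.⁻¹ ▷ x + - x                     ∎

      lowers-isSubgroup : ∀ {c} → IsSubgroup 𝔾 (Lowers c)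
      lowers-isSubgroup {c} = record
        { resp = lowers-cong {c} ; ε-closed = λ {_} {x} → lowers-ε {c} {x = x}
        ; ∙-closed = lowers-∙ {c} ; ⁻¹-closed = lowers-⁻¹ {c} }

      lowers-mono : ∀ {c c′ g} → c ℕ.≤ c′ → Lowers c′ g → Lowers c g
      lowers-mono c≤c′ l {d} v = V-mono js (ℕ.∸-monoʳ-≤ d c≤c′) (l v)

      Δs : ∀ {n} → Vector G.Carrier n → Carrier → Carrier
      Δs {zero}  S x = x
      Δs {suc n} S x = Δs (S ∘ suc) (Δ (S zero) x)

      V-Δs : ∀ {n} (S : Vector G.Carrier n) (c : Fin n → ℕ) → (∀ i → Lowers (c i) (S i)) →
             ∀ {d x} → V js d x → V js (d ∸ ∑ℕ c) (Δs S x)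
      V-Δs {zero}  S c l v = v
      V-Δs {suc n} S c l {d} {x} v = ≡.subst (λ e → V js e (Δs S x)) (ℕ.∸-+-assoc d (c zero) _)
        (V-Δs (S ∘ suc) (c ∘ suc) (l ∘ suc) (l zero v))

-- Coordinates of a direct sum of cyclic groups

module _ (m : ℕ) where
  private
    module Cₘ = AbelianGroup (C m)
  open CommutativeMonoidMult Cₘ.commutativeMonoid using () renaming (_×_ to _×ₘ_)

  ×ₘ≡* : ∀ n z → n ×ₘ z ≡ + n ℤ.* z
  ×ₘ≡* zero    z = ≡.refl
  ×ₘ≡* (suc n) z = ≡.trans (≡.cong (λ t → z ℤ.+ t) (×ₘ≡* n z)) (≡.sym (ℤ.suc-* (+ n) z))

  C-∣⇒≈0 : ∀ {z} → + m ℤ.∣ z → z ≡ 0ℤ [mod m ]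
  C-∣⇒≈0 {z} d = mod (≡.subst (+ m ℤ.∣_) (≡.sym (ℤ.+-identityʳ z)) d)

  C-≈0⇒∣ : ∀ {z} → z ≡ 0ℤ [mod m ] → + m ℤ.∣ z
  C-≈0⇒∣ {z} (mod d) = ≡.subst (+ m ℤ.∣_) (ℤ.+-identityʳ z) d

  C-annihilated : ∀ z → m ×ₘ z ≡ 0ℤ [mod m ]
  C-annihilated z = C-∣⇒≈0 (≡.subst (+ m ℤ.∣_) (≡.sym (×ₘ≡* m z)) (ℤ.∣m⇒∣m*n z ℤ.∣-refl))

  C-subgroup-multiples : {P : Pred ℤ ℓ} → IsSubgroup (C m) P → ∀ {c z} → P c → c ℤ.∣ z → P z
  C-subgroup-multiples {P = P} sub {c} Pc (ℤ.divides k ≡.refl) = go k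
    where
    open IsSubgroup sub

    natural : ∀ n → P (+ n ℤ.* c)
    natural zero    = ε-closed
    natural (suc n) = ≡.subst P (≡.sym (ℤ.suc-* (+ n) c)) (∙-closed Pc (natural n))

    go : ∀ k → P (k ℤ.* c)
    go (+ n)    = natural n
    go -[1+ n ] = ≡.subst P (ℤ.neg-distribˡ-* (+ suc n) c) (⁻¹-closed (natural (suc n)))

project : {A : Set} (H : A → AbelianGroup 0ℓ 0ℓ) → ∀ i → Π-abelianGroup H ⟶ H i
project H i = mkHom (Π-abelianGroup H) (H i) (λ x → x i) (λ x≈y → x≈y i) (λ _ _ → AbelianGroup.refl (H i))

module _ where
  open AbelianGroup

  -- Recursion on both indices, in place of a decision whether they are equal, avoids transporting x
  -- between the carriers.
  insert′ : ∀ {n} (H : Fin n → AbelianGroup 0ℓ 0ℓ) i → Carrier (H i) → ∀ j → Carrier (H j)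
  insert′ H zero    x zero    = x
  insert′ H zero    x (suc j) = ε (H (suc j))
  insert′ H (suc i) x zero    = ε (H zero)
  insert′ H (suc i) x (suc j) = insert′ (H ∘ suc) i x j

  insert : ∀ {n} (H : Fin n → AbelianGroup 0ℓ 0ℓ) i → H i ⟶ Π-abelianGroup H
  insert H i = mkHom (H i) (Π-abelianGroup H) (insert′ H i) (ins-cong H i) (ins-∙ H i)
    where
    ins-cong : ∀ {n} (H : Fin n → AbelianGroup 0ℓ 0ℓ) i {x y} → _≈_ (H i) x y → ∀ j →
               _≈_ (H j) (insert′ H i x j) (insert′ H i y j)
    ins-cong H zero    x≈y zero    = x≈y
    ins-cong H zero    x≈y (suc j) = refl (H (suc j))
    ins-cong H (suc i) x≈y zero    = refl (H zero)
    ins-cong H (suc i) x≈y (suc j) = ins-cong (H ∘ suc) i x≈y j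

    ins-∙ : ∀ {n} (H : Fin n → AbelianGroup 0ℓ 0ℓ) i x y j →
            _≈_ (H j) (insert′ H i (_∙_ (H i) x y) j) (_∙_ (H j) (insert′ H i x j) (insert′ H i y j))
    ins-∙ H zero    x y zero    = refl (H zero)
    ins-∙ H zero    x y (suc j) = sym (H (suc j)) (identityˡ (H (suc j)) _)
    ins-∙ H (suc i) x y zero    = sym (H zero) (identityˡ (H zero) _)
    ins-∙ H (suc i) x y (suc j) = ins-∙ (H ∘ suc) i x y j

  insert-self : ∀ {n} (H : Fin n → AbelianGroup 0ℓ 0ℓ) i x → _≈_ (H i) (insert′ H i x i) x
  insert-self H zero    x = refl (H zero)
  insert-self H (suc i) x = insert-self (H ∘ suc) i x

  -- A tuple is the sum of its inserted components. The induction peels off the first component and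
  -- pulls the subgroup back along the embedding of the remaining factors.
  insert-generate : ∀ {n} (H : Fin n → AbelianGroup 0ℓ 0ℓ) {P : Pred (∀ i → Carrier (H i)) ℓ} →
                    IsSubgroup (Π-abelianGroup H) P → ∀ x → (∀ i → P (insert′ H i (x i))) → P x
  insert-generate {n = zero}  H sub x _ = IsSubgroup.resp sub (λ ()) (IsSubgroup.ε-closed sub)
  insert-generate {n = suc n} H {P} sub x Px =
    S.resp split (S.∙-closed (Px zero)
      (insert-generate (H ∘ suc) (preimage (Π-abelianGroup (H ∘ suc)) (Π-abelianGroup H) extend sub) (λ i → x (suc i))
        (λ i → S.resp (extend-insert i) (Px (suc i)))))
    where
    module S = IsSubgroup sub

    cons0 : (∀ i → Carrier (H (suc i))) → ∀ i → Carrier (H i)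
    cons0 y zero    = ε (H zero)
    cons0 y (suc i) = y i

    extend : Π-abelianGroup (H ∘ suc) ⟶ Π-abelianGroup H
    extend = mkHom (Π-abelianGroup (H ∘ suc)) (Π-abelianGroup H) cons0
      (λ { x≈y zero → refl (H zero) ; x≈y (suc i) → x≈y i })
      (λ { x y zero → sym (H zero) (identityˡ (H zero) _) ; x y (suc i) → refl (H (suc i)) })

    extend-insert : ∀ i j → _≈_ (H j) (insert′ H (suc i) (x (suc i)) j) (cons0 (insert′ (H ∘ suc) i (x (suc i))) j)
    extend-insert i zero    = refl (H zero)
    extend-insert i (suc j) = refl (H (suc j))

    split : ∀ j → _≈_ (H j) (_∙_ (H j) (insert′ H zero (x zero) j) (cons0 (λ i → x (suc i)) j)) (x j)
    split zero    = identityʳ (H zero) _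
    split (suc j) = identityˡ (H (suc j)) _

-- Zero-sum free families over p-groups

module FunctionSpace (G : FiniteAbelianGroup c ℓ) {p : ℕ} (pp : Prime p) where

  open FiniteAbelianGroup G

  private
    module Cₚ = AbelianGroup (C p)
    module CₚProps = AbelianGroupProperties (C p)

  functions : AbelianGroup 0ℓ 0ℓ
  functions = Pointwise.abelianGroup (Fin order) (C p)

  open AbelianGroup functions using () renaming (Carrier to Function; _≈_ to _≈ᶠ_; ε to 0ᶠ)
  open CommutativeMonoidMult (AbelianGroup.commutativeMonoid functions) using () renaming (_×_ to _×ᶠ_)

  -- Functions on the index set, rather than on the carrier, automatically respect the setoid equality of G.
  translate : Carrier → Function → Function
  translate g f i = f (index (element i ⊕ g))

  translation : Action abelianGroup functions
  translation = record
    { _▷_    = translate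
    ; ▷-cong = λ {g} {h} {x} g≈h x≈y i →
        Cₚ.trans (Cₚ.reflexive (≡.cong x (index-cong (∙-congˡ g≈h)))) (x≈y _)
    ; ▷-+    = λ g x y i → Cₚ.refl
    ; ▷-∙    = λ g h x i → Cₚ.reflexive (≡.cong x (index-cong
        (trans (sym (assoc _ _ _)) (∙-congʳ (sym (element-index _))))))
    ; ▷-ε    = λ x i → Cₚ.reflexive (≡.cong x (≡.trans (index-cong (identityʳ _)) (index-element i)))
    }

  open Differences translation public

  evaluate : ∀ i → functions ⟶ C p
  evaluate i = mkHom functions (C p) (λ f → f i) (λ x≈y → x≈y i) (λ _ _ → Cₚ.refl)

  p×ᶠ≈0 : ∀ x → p ×ᶠ x ≈ᶠ 0ᶠ
  p×ᶠ≈0 x i = Cₚ.trans (Hom.×-homo functions (C p) (evaluate i) p x) (C-annihilated p (x i))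

  open Characteristic pp p×ᶠ≈0 public

  σ-∅ : ∀ {N} (S : Vector Carrier N) → σ G S ∅ ≈ 0#
  σ-∅ {zero}  S = refl
  σ-∅ {suc N} S = trans (identityˡ _) (σ-∅ (S ∘ suc))

  module _ {J : Set} (u : J → Carrier) (w : J → ℕ) (js : List J) where

    open Filtration u w

    -- The value of Δs js S f at i is an alternating sum of the values of f at i ⊕ σ(J), J ⊆ S.
    Δs-support : ∀ {N} (S : Vector Carrier N) f i →
      (∀ J → Nonempty J → f (index (element i ⊕ σ G S J)) ≡ 0ℤ [mod p ]) →
      Δs js S f ≈ᶠ 0ᶠ → f i ≡ 0ℤ [mod p ]
    Δs-support {zero}  S f i _ Δs≈0 = Δs≈0 i
    Δs-support {suc N} S f i f-off Δs≈0 = Cₚ.trans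
      -- By induction `Δ g f` vanishes at i, so f takes the same value at i and at i ⊕ g; the latter
      -- is zero by the hypothesis for the singleton `inside ∷ ∅`.
      (Cₚ.sym (CₚProps.x∙y⁻¹≈ε⇒x≈y (translate g f i) (f i) (Δs-support (S ∘ suc) (Δ g f) i Δ-off Δs≈0)))
      (f-off′ (inside ∷ ∅) (zero , here) (index-cong (∙-congˡ (trans (∙-congˡ (σ-∅ (S ∘ suc))) (identityʳ g)))))
      where
      g = S zero

      f-off′ : ∀ J → Nonempty J → ∀ {j} → index (element i ⊕ σ G S J) ≡ j → f j ≡ 0ℤ [mod p ]
      f-off′ J ne ≡.refl = f-off J ne

      -- The difference involves f at two subset sums of S, with and without the first element, and
      -- both subsets are nonempty.
      Δ-off : ∀ J → Nonempty J → Δ g f (index (element i ⊕ σ G (S ∘ suc) J)) ≡ 0ℤ [mod p ]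
      Δ-off J (x , x∈J) = Cₚ.trans
        (Cₚ.∙-cong {y = 0ℤ} {v = 0ℤ}
          (f-off′ (inside ∷ J) (suc x , there x∈J) (index-cong (trans
            (∙-congˡ (comm g _)) (trans (sym (assoc _ _ g)) (∙-congʳ (sym (element-index _)))))))
          (Cₚ.⁻¹-cong {y = 0ℤ} (f-off′ (outside ∷ J) (suc x , there x∈J) (index-cong (∙-congˡ (identityˡ _))))))
        (Cₚ.identityʳ 0ℤ)

    module _ (q : J → ℕ) (Δ^q≈0 : ∀ j x → Δ^ (q j) (u j) x ≈ᶠ 0ᶠ) where

      -- If the total weight exceeded the degree, the truncated filtration index would drop to 0 and
      -- `Δs js S` would annihilate the indicator δ of 0. As δ vanishes at all nonempty subset sums,
      -- `Δs-support` would then make its value 1 at 0 divisible by p.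
      zeroSumFree⇒∑≤degree : ∀ {N} (S : Vector Carrier N) → ZeroSumFree G S →
        (c : Fin N → ℕ) → (∀ i → Lowers js (c i) (S i)) → ∑ℕ c ℕ.≤ degree q js
      zeroSumFree⇒∑≤degree S free c lowers = ℕ.≮⇒≥ λ d<∑c → 1≢0 (≡.subst (_≡ 0ℤ [mod p ]) δ₀≡1
        (Δs-support S δ i₀ δ-off (V₀⇒≈0 js (≡.subst (λ e → V js e (Δs js S δ)) (ℕ.m≤n⇒m∸n≡0 d<∑c)
          (V-Δs js S c lowers (V-degree q Δ^q≈0 js δ))))))
        where
        i₀ = index 0#

        δ : Function
        δ i = if does (i Fin.≟ i₀) then 1ℤ else 0ℤ

        δ₀≡1 : δ i₀ ≡ 1ℤ
        δ₀≡1 with i₀ Fin.≟ i₀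
        ... | yes _ = ≡.refl
        ... | no ¬p = contradiction ≡.refl ¬p

        δ-off : ∀ J → Nonempty J → δ (index (element i₀ ⊕ σ G S J)) ≡ 0ℤ [mod p ]
        δ-off J ne with index (element i₀ ⊕ σ G S J) Fin.≟ i₀
        ... | no _  = Cₚ.refl
        ... | yes eq = contradiction (begin
          σ G S J                                        ≈⟨ identityˡ _ ⟨
          0# ⊕ σ G S J                                   ≈⟨ ∙-congʳ (element-index 0#) ⟨
          element i₀ ⊕ σ G S J                           ≈⟨ element-index _ ⟨
          element (index (element i₀ ⊕ σ G S J))         ≡⟨ ≡.cong element eq ⟩
          element i₀                                     ≈⟨ element-index 0# ⟩
          0#                                             ∎) (free J ne)
          where open SetoidReasoning setoid

        1≢0 : ¬ 1ℤ ≡ 0ℤ [mod p ]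
        1≢0 1≡0 = ℕ.nonTrivial⇒≢1 {{prime⇒nonTrivial pp}} (ℕ.∣1⇒≡1 (ℤ.∣⇒∣ᵤ (C-≈0⇒∣ p 1≡0)))

-- Cyclic coordinates of G and weights of its elements

module _ (G : FiniteAbelianGroup c ℓ) (D : PrimePowers) where

  open FiniteAbelianGroup G
  open PrimePowers D

  module Coordinates (iso : abelianGroup ≅ ⨁ D) where

    private
      module ⨁D = AbelianGroup (⨁ D)
      module Iso = GroupMorphisms.IsGroupIsomorphism (proj₂ iso)

    φ : abelianGroup ⟶ ⨁ D
    φ = proj₁ iso , Iso.isGroupHomomorphism

    ψ⟨_⟩ : ⨁D.Carrier → Carrier
    ψ⟨ y ⟩ = proj₁ (Iso.surjective y)

    φψ : ∀ y → proj₁ φ ψ⟨ y ⟩ ⨁D.≈ y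
    φψ y = proj₂ (Iso.surjective y) refl

    ψ : ⨁ D ⟶ abelianGroup
    ψ = mkHom (⨁ D) abelianGroup ψ⟨_⟩
      (λ {x} {y} x≈y → Iso.injective (⨁D.trans (φψ x) (⨁D.trans x≈y (⨁D.sym (φψ y)))))
      (λ x y → Iso.injective (⨁D.trans (φψ _)
        (⨁D.trans (⨁D.sym (⨁D.∙-cong (φψ x) (φψ y))) (⨁D.sym (Iso.∙-homo _ _)))))

    J = Σ (Fin n) (Fin ∘ r)

    q : J → ℕ
    q (i , j) = p i ^ e i j

    summands : ∀ i → Fin (r i) → AbelianGroup 0ℓ 0ℓ
    summands i j = C (q (i , j))

    rows : Fin n → AbelianGroup 0ℓ 0ℓ
    rows i = Π-abelianGroup (summands i)

    π : ∀ α → abelianGroup ⟶ C (q α)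
    π α@(i , j) = compose abelianGroup (rows i) (C (q α))
      (compose abelianGroup (⨁ D) (rows i) φ (project rows i)) (project (summands i) j)

    ι : ∀ α → C (q α) ⟶ abelianGroup
    ι α@(i , j) = compose (C (q α)) (⨁ D) abelianGroup
      (compose (C (q α)) (rows i) (⨁ D) (insert (summands i) j) (insert rows i)) ψ

    -- `insert-generate` is applied twice, to the rows and then to the summands of each row, after
    -- moving the subgroup across the isomorphism.
    generated : {P : Pred Carrier ℓ₁} → IsSubgroup abelianGroup P →
                ∀ g → (∀ α → P (proj₁ (ι α) (proj₁ (π α) g))) → P g
    generated sub g Pg = S.resp (Iso.injective (φψ _))
      (insert-generate rows sub₁ (proj₁ φ g) λ i →
        insert-generate (summands i) (preimage (rows i) (⨁ D) (insert rows i) sub₁) (proj₁ φ g i) λ j → Pg (i , j))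
      where
      module S = IsSubgroup sub
      sub₁ = preimage (⨁ D) abelianGroup ψ sub

    π-ι : ∀ α z → proj₁ (π α) (proj₁ (ι α) z) ≡ z [mod q α ]
    π-ι α@(i , j) z = Cq.trans (φψ _ i j) (Cq.trans (insert-self rows i _ j) (insert-self (summands i) j z))
      where module Cq = AbelianGroup (C (q α))

    indices : List J
    indices = List.concat (List.tabulate λ i → List.tabulate (i ,_))

    ∈-indices : ∀ α → α ∈ˡ indices
    ∈-indices (i , j) = ∈-concat⁺′ (∈-tabulate⁺ {f = i ,_} j) (∈-tabulate⁺ {f = λ i → List.tabulate (i ,_)} i)

    ι-× : ∀ α m z → m · proj₁ (ι α) z ≈ proj₁ (ι α) (+ m ℤ.* z)
    ι-× α m z = trans (sym (Hom.×-homo (C (q α)) abelianGroup (ι α) m z))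
      (reflexive (≡.cong (proj₁ (ι α)) (×ₘ≡* (q α) m z)))

    annihilated⇒q∣ : ∀ {m g} → m · g ≈ 0# → ∀ α → + q α ℤ.∣ + m ℤ.* proj₁ (π α) g
    annihilated⇒q∣ {m} {g} mg≈0 α = C-≈0⇒∣ (q α) (begin
      + m ℤ.* proj₁ (π α) g     ≡⟨ ×ₘ≡* (q α) m _ ⟨
      m ×q proj₁ (π α) g        ≈⟨ πα.×-homo m g ⟨
      proj₁ (π α) (m · g)       ≈⟨ πα.⟦⟧-cong mg≈0 ⟩
      proj₁ (π α) 0#            ≈⟨ πα.ε-homo ⟩
      0ℤ                        ∎)
      where
      module Cq = AbelianGroup (C (q α))
      module πα = Hom abelianGroup (C (q α)) (π α)
      open CommutativeMonoidMult Cq.commutativeMonoid using () renaming (_×_ to _×q_)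
      open SetoidReasoning Cq.setoid

    module _ {p₀ : ℕ} (pp : Prime p₀) (isPGroup : IsPGroup G p₀) where

      -- The generator of the summand is killed by some power of p₀. Projecting back to the summand
      -- shows that its order `q α` divides this power, and `p i` divides `q α`.
      p-unique : ∀ α → p (proj₁ α) ≡ p₀
      p-unique α@(i , j) = prime∣^⇒≡ l (ℕ.∣-trans p∣q q∣pᵏ)
        where
        g = proj₁ (ι α) 1ℤ
        l = proj₁ (isPGroup g)

        p∣q : p i ∣ q α
        p∣q = ≡.subst (p i ∣_) (≡.cong (p i ^_) (ℕ.m+[n∸m]≡n (e≥1 i j))) (ℕ.m∣m*n (p i ^ (e i j ∸ 1)))

        q∣pᵏ : q α ∣ p₀ ^ l
        q∣pᵏ = ℤ.∣⇒∣ᵤ (C-≈0⇒∣ (q α) {+ (p₀ ^ l)} (begin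
          + (p₀ ^ l)                                    ≡⟨ ℤ.*-identityʳ _ ⟨
          + (p₀ ^ l) ℤ.* 1ℤ                             ≈⟨ π-ι α _ ⟨
          proj₁ (π α) (proj₁ (ι α) (+ (p₀ ^ l) ℤ.* 1ℤ)) ≈⟨ πα.⟦⟧-cong (ι-× α (p₀ ^ l) 1ℤ) ⟨
          proj₁ (π α) ((p₀ ^ l) · g)                    ≈⟨ πα.⟦⟧-cong (≡.subst (λ m → m · g ≈ 0#)
                                                             (proj₂ (isPGroup g)) (ord-annihilates g)) ⟩
          proj₁ (π α) 0#                                ≈⟨ πα.ε-homo ⟩
          0ℤ                                            ∎))
          where
          module Cq = AbelianGroup (C (q α))
          module πα = Hom abelianGroup (C (q α)) (π α)
          open SetoidReasoning Cq.setoid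

        prime∣^⇒≡ : ∀ k → p i ∣ p₀ ^ k → p i ≡ p₀
        prime∣^⇒≡ zero    p∣1 = contradiction (ℕ.∣1⇒≡1 p∣1) (ℕ.nonTrivial⇒≢1 {{prime⇒nonTrivial (p-prime i)}})
        prime∣^⇒≡ (suc k) p∣pp with euclidsLemma p₀ (p₀ ^ k) (p-prime i) p∣pp
        ... | inj₂ p∣pᵏ = prime∣^⇒≡ k p∣pᵏ
        ... | inj₁ p∣p₀ with prime⇒irreducible pp p∣p₀
        ...   | inj₂ eq = eq
        ...   | inj₁ eq = contradiction eq (ℕ.nonTrivial⇒≢1 {{prime⇒nonTrivial (p-prime i)}})

      module _ (h : ℕ) where

        private
          instance
            p₀≢0 : NonZero p₀
            p₀≢0 = prime⇒nonZero pp

          eᵅ : J → ℕ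
          eᵅ (i , j) = e i j

          q≡ : ∀ α → q α ≡ p₀ ^ eᵅ α
          q≡ α = ≡.cong (_^ eᵅ α) (p-unique α)

        -- The reciprocal order of the generator `u α`, scaled by `p₀ ^ h` to a natural number when
        -- `eᵅ α ≤ h`.
        w : J → ℕ
        w α = p₀ ^ (h ∸ eᵅ α)

        u : J → Carrier
        u α = proj₁ (ι α) 1ℤ

        open FunctionSpace G pp
        open Filtration u w
        private module Fun = AbelianGroup functions

        -- By Frobenius this power is `Δ` of `q α · u α`, which is zero in G.
        Δ^q≈0 : ∀ α x → Δ^ (q α) (u α) x Fun.≈ Fun.ε
        Δ^q≈0 α x = ≡.subst (λ m → m · u α ≈ 0# → Δ^ m (u α) x Fun.≈ Fun.ε) (≡.sym (q≡ α))
          (λ qu≈0 → Fun.trans (Fun.sym (frobenius (eᵅ α) (u α) x))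
            (Fun.trans (Δ-cong {y = x} qu≈0 Fun.refl) (Δ-ε x)))
          (trans (ι-× α (q α) 1ℤ) (trans (ια.⟦⟧-cong (C-∣⇒≈0 (q α) (ℤ.∣m⇒∣m*n 1ℤ ℤ.∣-refl))) ια.ε-homo))
          where module ια = Hom (C (q α)) abelianGroup (ι α)

        -- With `s = eᵅ α ∸ k`, the element is `p₀ ^ s` times the generator, so Frobenius gives it
        -- weight `p₀ ^ s ℕ.* w α`. Truncated subtraction also covers k beyond `eᵅ α`, where the
        -- element is the generator itself.
        lowers-generator : ∀ k α → Lowers indices (p₀ ^ (h ∸ k)) (proj₁ (ι α) (+ (p₀ ^ (eᵅ α ∸ k))))
        lowers-generator k α = lowers-cong indices {p₀ ^ (h ∸ k)}
          (trans (ι-× α (p₀ ^ s) 1ℤ) (reflexive (≡.cong (proj₁ (ι α)) (ℤ.*-identityʳ _))))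
          (lowers-mono indices {p₀ ^ (h ∸ k)} cost λ {_} {x} v →
            V-cong indices (Fun.sym (frobenius s (u α) x)) (V-Δ^ indices (∈-indices α) (p₀ ^ s) v))
          where
          s = eᵅ α ∸ k

          exponents : h ∸ k ℕ.≤ s ℕ.+ (h ∸ eᵅ α)
          exponents = ℕ.m≤n+o⇒m∸n≤o h k (begin
            h                            ≤⟨ ℕ.m≤n+m∸n h (eᵅ α) ⟩
            eᵅ α ℕ.+ (h ∸ eᵅ α)          ≤⟨ ℕ.+-monoˡ-≤ _ (ℕ.m≤n+m∸n (eᵅ α) k) ⟩
            k ℕ.+ s ℕ.+ (h ∸ eᵅ α)       ≡⟨ ℕ.+-assoc k s _ ⟩
            k ℕ.+ (s ℕ.+ (h ∸ eᵅ α))     ∎)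
            where open ℕ.≤-Reasoning

          cost : p₀ ^ (h ∸ k) ℕ.≤ p₀ ^ s ℕ.* w α
          cost = ≡.subst (p₀ ^ (h ∸ k) ℕ.≤_) (ℕ.^-distribˡ-+-* p₀ s (h ∸ eᵅ α)) (ℕ.^-monoʳ-≤ p₀ exponents)

        -- For k at most `eᵅ α`, cancel `p₀ ^ k` from the divisibility of `p₀ ^ k` times the
        -- coordinate by `q α`; otherwise the divisor is 1.
        coordinate-divisible : ∀ k g → (p₀ ^ k) · g ≈ 0# → ∀ α → + (p₀ ^ (eᵅ α ∸ k)) ℤ.∣ proj₁ (π α) g
        coordinate-divisible k g pᵏg≈0 α with ℕ.≤-total k (eᵅ α)
        ... | inj₂ e≤k rewrite ℕ.m≤n⇒m∸n≡0 e≤k = ℤ.divides (proj₁ (π α) g) (≡.sym (ℤ.*-identityʳ _))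
        ... | inj₁ k≤e = ℤ.*-cancelˡ-∣ (+ (p₀ ^ k)) {{ℕ.m^n≢0 p₀ k}}
          (≡.subst (ℤ._∣ + (p₀ ^ k) ℤ.* proj₁ (π α) g) factor (annihilated⇒q∣ {p₀ ^ k} pᵏg≈0 α))
          where
          factor : + q α ≡ + (p₀ ^ k) ℤ.* + (p₀ ^ (eᵅ α ∸ k))
          factor = begin
            + q α                                   ≡⟨ ≡.cong +_ (q≡ α) ⟩
            + (p₀ ^ eᵅ α)                           ≡⟨ ≡.cong (λ m → + (p₀ ^ m)) (ℕ.m+[n∸m]≡n k≤e) ⟨
            + (p₀ ^ (k ℕ.+ (eᵅ α ∸ k)))             ≡⟨ ≡.cong +_ (ℕ.^-distribˡ-+-* p₀ k _) ⟩
            + (p₀ ^ k ℕ.* p₀ ^ (eᵅ α ∸ k))          ≡⟨ ℤ.pos-* (p₀ ^ k) _ ⟩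
            + (p₀ ^ k) ℤ.* + (p₀ ^ (eᵅ α ∸ k))      ∎
            where open ≡.≡-Reasoning

        -- Every component of g is a multiple of an element treated in `lowers-generator`, and the
        -- elements of at least a given weight form a subgroup.
        lowers : ∀ k g → (p₀ ^ k) · g ≈ 0# → Lowers indices (p₀ ^ (h ∸ k)) g
        lowers k g pᵏg≈0 = generated sub g λ α →
          C-subgroup-multiples (q α) (preimage (C (q α)) abelianGroup (ι α) sub)
            (lowers-generator k α) (coordinate-divisible k g pᵏg≈0 α)
          where sub = lowers-isSubgroup indices {p₀ ^ (h ∸ k)}

        -- When h bounds all exponents and `p₀ ^ k x` is the order of `S x`, this is the inequality
        -- between k(S) and k*(G) multiplied by `p₀ ^ h`.
        zeroSumFree⇒weights≤ : ∀ {N} (S : Vector Carrier N) → ZeroSumFree G S →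
          (k : Fin N → ℕ) → (∀ x → (p₀ ^ k x) · S x ≈ 0#) →
          ∑ℕ (λ x → p₀ ^ (h ∸ k x)) ℕ.≤ ∑ℕ (λ i → ∑ℕ (λ j → ℕ.pred (p i ^ e i j) ℕ.* p₀ ^ (h ∸ e i j)))
        zeroSumFree⇒weights≤ S free k killed = ≡.subst (_ ℕ.≤_)
          (≡.trans (weightOf-concat t (λ i → List.tabulate (i ,_)))
            (CommutativeMonoidSum.sum-cong-≗ ℕ.+-0-commutativeMonoid λ i → weightOf-tabulate t (i ,_)))
          (zeroSumFree⇒∑≤degree u w indices q Δ^q≈0 S free _ (λ x → lowers (k x) (S x) (killed x)))
          where
          t : J → ℕ
          t α = ℕ.pred (q α) ℕ.* w α

-- Unique factorization

-- Lists X in increasing order, which makes S(X) an indexed family `S ∘ select X` in its own right.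
select : (X : Subset N) → Fin ∣ X ∣ → Fin N
select (inside  ∷ X) zero    = zero
select (inside  ∷ X) (suc i) = suc (select X i)
select (outside ∷ X) i       = suc (select X i)

-- The direct image under `select X`.
embed : (X : Subset N) → Subset ∣ X ∣ → Subset N
embed []            []      = []
embed (inside  ∷ X) (j ∷ J) = j ∷ embed X J
embed (outside ∷ X) J       = outside ∷ embed X J

embed-⊆ : (X : Subset N) (J : Subset ∣ X ∣) → embed X J ⊆ X
embed-⊆ (inside  ∷ X) (j ∷ J) here       = here
embed-⊆ (inside  ∷ X) (j ∷ J) (there x∈) = there (embed-⊆ X J x∈)
embed-⊆ (outside ∷ X) J       (there x∈) = there (embed-⊆ X J x∈)

select-∈-embed : (X : Subset N) (J : Subset ∣ X ∣) → ∀ {i} → i ∈ J → select X i ∈ embed X J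
select-∈-embed (inside  ∷ X) (j ∷ J) here       = here
select-∈-embed (inside  ∷ X) (j ∷ J) (there i∈) = there (select-∈-embed X J i∈)
select-∈-embed (outside ∷ X) J       i∈         = there (select-∈-embed X J i∈)

module _ (M : CommutativeMonoid c ℓ) where
  open CommutativeMonoid M
  open CommutativeMonoidSum M using (sum)
  open CommutativeSemigroupProperties commutativeSemigroup using (x∙yz≈y∙xz)

  sum-split : (X : Subset N) (f : Fin N → Carrier) → sum f ≈ sum (f ∘ select X) ∙ sum (f ∘ select (∁ X))
  sum-split []            f = sym (identityˡ ε)
  sum-split (inside  ∷ X) f = trans (∙-congˡ (sum-split X (f ∘ suc))) (sym (assoc _ _ _))
  sum-split (outside ∷ X) f = trans (∙-congˡ (sum-split X (f ∘ suc))) (x∙yz≈y∙xz _ _ _)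

image : ∀ {m} → (Fin m → Fin N) → Subset N
image {m = zero}  x = ∅
image {m = suc m} x = ⁅ x zero ⁆ ∪ image (x ∘ suc)

∈-image : ∀ {m} (x : Fin m → Fin N) i → x i ∈ image x
∈-image x zero    = Subset.x∈p∪q⁺ (inj₁ (Subset.x∈⁅x⁆ (x zero)))
∈-image x (suc i) = Subset.x∈p∪q⁺ (inj₂ (∈-image (x ∘ suc) i))

∣⁅x⁆∪p∣≤1+∣p∣ : ∀ x (p : Subset N) → ∣ ⁅ x ⁆ ∪ p ∣ ℕ.≤ suc ∣ p ∣
∣⁅x⁆∪p∣≤1+∣p∣ zero    (s ∷ p)       rewrite Subset.∪-identityˡ p = s≤s (Subset.∣p∣≤∣x∷p∣ s p)
∣⁅x⁆∪p∣≤1+∣p∣ (suc x) (inside  ∷ p) = s≤s (∣⁅x⁆∪p∣≤1+∣p∣ x p)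
∣⁅x⁆∪p∣≤1+∣p∣ (suc x) (outside ∷ p) = ∣⁅x⁆∪p∣≤1+∣p∣ x p

∣image∣≤ : ∀ {m} (x : Fin m → Fin N) → ∣ image x ∣ ℕ.≤ m
∣image∣≤ {N = N} {zero}  x = ℕ.≤-reflexive (Subset.∣⊥∣≡0 N)
∣image∣≤ {m = suc m} x = ℕ.≤-trans (∣⁅x⁆∪p∣≤1+∣p∣ (x zero) _) (s≤s (∣image∣≤ (x ∘ suc)))

module _ (G : FiniteAbelianGroup c ℓ) where
  open FiniteAbelianGroup G
  open CommutativeSemigroupProperties (CommutativeMonoid.commutativeSemigroup commutativeMonoid) using (x∙yz≈y∙xz)
  open CommutativeMonoidMult commutativeMonoid using (×-homo-1; ×-homo-+; ×-assocˡ; ×-congʳ)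
  open SetoidReasoning setoid

  σ-embed : (S : Vector Carrier N) (X : Subset N) (J : Subset ∣ X ∣) → σ G S (embed X J) ≈ σ G (S ∘ select X) J
  σ-embed S []            []      = refl
  σ-embed S (inside  ∷ X) (j ∷ J) = ∙-congˡ (σ-embed (S ∘ suc) X J)
  σ-embed S (outside ∷ X) J       = trans (identityˡ _) (σ-embed (S ∘ suc) X J)

  σ-split : (S : Vector Carrier N) {T B : Subset N} → B ⊆ T → σ G S T ≈ σ G S B ⊕ σ G S (T ∩ ∁ B)
  σ-split S {[]}          {[]}          B⊆T = sym (identityˡ 0#)
  σ-split S {t ∷ T}       {outside ∷ B} B⊆T rewrite ∧-identityʳ t =
    trans (∙-congˡ (σ-split (S ∘ suc) (Subset.drop-∷-⊆ B⊆T)))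
      (trans (x∙yz≈y∙xz _ _ _) (∙-congʳ (sym (identityˡ _))))
  σ-split S {inside ∷ T}  {inside ∷ B}  B⊆T = trans (∙-congˡ (σ-split (S ∘ suc) (Subset.drop-∷-⊆ B⊆T)))
    (trans (sym (assoc _ _ _)) (∙-congˡ (sym (identityˡ _))))
  σ-split S {outside ∷ T} {inside ∷ B}  B⊆T = contradiction (B⊆T here) λ ()

  module _ (S : Vector Carrier N) where

    -- Well-founded descent along strict inclusion; the search for a smaller nonempty zero-sum
    -- subset is finite and decidable.
    minimalZeroSum-⊆ : ∀ T → Nonempty T → ZeroSum G S T →
                       ∃[ B ] B ⊆ T × Nonempty B × MinimalZeroSum G S B
    minimalZeroSum-⊆ T = go T (⊂-wellFounded T)
      where
      go : ∀ T → Acc _⊂_ T → Nonempty T → ZeroSum G S T → ∃[ B ] B ⊆ T × Nonempty B × MinimalZeroSum G S B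
      go T (acc rec) ne zs
        with Subset.anySubset? (λ J → Subset.nonempty? J ×-dec (J Subset.⊂? T) ×-dec (σ G S J ≟ 0#))
      ... | no none = T , id , ne , zs , λ J neJ J⊂T zsJ → none (J , neJ , J⊂T , zsJ)
      ... | yes (J , neJ , J⊂T , zsJ) with go J (rec J⊂T) neJ zsJ
      ...   | B , B⊆J , neB , minB = B , Subset.p⊂q⇒p⊆q J⊂T ∘ B⊆J , neB , minB

    -- Relative to a set T of indices, so that the remainder after splitting off a block can be
    -- factored without reindexing S.
    record FactorizationOf (T : Subset N) {m} (I : Vector (Subset N) m) : Set ℓ where
      field
        nonempty  : ∀ i → Nonempty (I i)
        disjoint  : ∀ {i j} → i ≢ j → Empty (I i ∩ I j)
        contained : ∀ i → I i ⊆ T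
        covers    : ∀ {x} → x ∈ T → ∃[ i ] x ∈ I i
        minimal   : ∀ i → MinimalZeroSum G S (I i)

    infixr 5 _∷ᵇ_

    _∷ᵇ_ : ∀ {m} → Subset N → Vector (Subset N) m → Vector (Subset N) (suc m)
    (B ∷ᵇ I) zero    = B
    (B ∷ᵇ I) (suc i) = I i

    ∷-factorization : ∀ {T B m} {I : Vector (Subset N) m} → B ⊆ T → Nonempty B → MinimalZeroSum G S B →
                      FactorizationOf (T ∩ ∁ B) I → FactorizationOf T (B ∷ᵇ I)
    ∷-factorization {T} {B} {m} {I} B⊆T neB minB F = record
      { nonempty  = λ { zero → neB ; (suc i) → F.nonempty i }
      ; disjoint  = disj
      ; contained = λ { zero → B⊆T ; (suc i) → proj₁ ∘ split ∘ F.contained i }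
      ; covers    = cov
      ; minimal   = λ { zero → minB ; (suc i) → F.minimal i }
      }
      where
      module F = FactorizationOf F

      split : ∀ {x} → x ∈ T ∩ ∁ B → x ∈ T × x ∈ ∁ B
      split = Subset.x∈p∩q⁻ T (∁ B)

      apart : ∀ i {x} → x ∈ B → x ∉ I i
      apart i x∈B x∈I = Subset.x∈∁p⇒x∉p (proj₂ (split (F.contained i x∈I))) x∈B

      disj : ∀ {i j} → i ≢ j → Empty ((B ∷ᵇ I) i ∩ (B ∷ᵇ I) j)
      disj {zero}  {zero}  i≢j _ = i≢j ≡.refl
      disj {zero}  {suc j} _ (x , x∈) = let x∈B , x∈I = Subset.x∈p∩q⁻ B (I j) x∈ in apart j x∈B x∈I
      disj {suc i} {zero}  _ (x , x∈) = let x∈I , x∈B = Subset.x∈p∩q⁻ (I i) B x∈ in apart i x∈B x∈I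
      disj {suc i} {suc j} i≢j = F.disjoint (i≢j ∘ ≡.cong suc)

      cov : ∀ {x} → x ∈ T → ∃[ i ] x ∈ (B ∷ᵇ I) i
      cov {x} x∈T with x Subset.∈? B
      ... | yes x∈B = zero , x∈B
      ... | no x∉B  = let i , x∈I = F.covers (Subset.x∈p∩q⁺ (x∈T , Subset.x∉p⇒x∈∁p x∉B)) in suc i , x∈I

    remainder-zeroSum : ∀ {T B} → B ⊆ T → ZeroSum G S T → ZeroSum G S B → ZeroSum G S (T ∩ ∁ B)
    remainder-zeroSum {T} {B} B⊆T zsT zsB = begin
      σ G S (T ∩ ∁ B)                ≈⟨ identityˡ _ ⟨
      0# ⊕ σ G S (T ∩ ∁ B)           ≈⟨ ∙-congʳ zsB ⟨
      σ G S B ⊕ σ G S (T ∩ ∁ B)      ≈⟨ σ-split S B⊆T ⟨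
      σ G S T                        ≈⟨ zsT ⟩
      0#                             ∎

    -- Split off a minimal zero-sum block; what remains is again zero-sum, and strictly smaller
    -- because the block is nonempty.
    factorization-exists : ∀ T → ZeroSum G S T → ∃[ m ] Σ[ I ∈ Vector (Subset N) m ] FactorizationOf T I
    factorization-exists T = go T (⊂-wellFounded T)
      where
      go : ∀ T → Acc _⊂_ T → ZeroSum G S T → ∃[ m ] Σ[ I ∈ Vector (Subset N) m ] FactorizationOf T I
      go T (acc rec) zs with Subset.nonempty? T
      ... | no empty = 0 , (λ ()) , record
        { nonempty = λ () ; disjoint = λ { {()} } ; contained = λ ()
        ; covers = λ x∈T → contradiction (_ , x∈T) empty ; minimal = λ () }
      ... | yes ne with minimalZeroSum-⊆ T ne zs
      ...   | B , B⊆T , neB@(y , y∈B) , minB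
            with go (T ∩ ∁ B)
                   (rec (Subset.p∩q⊆p T (∁ B) , y , B⊆T y∈B ,
                     λ y∈ → Subset.x∈∁p⇒x∉p (Subset.p∩q⊆q T (∁ B) y∈) y∈B))
                   (remainder-zeroSum B⊆T zs (proj₁ minB))
      ...     | m , I , F = suc m , (B ∷ᵇ I) , ∷-factorization B⊆T neB minB F

    -- A zero-sum subset contains an irreducible factor B, and B together with a factorization of
    -- its complement is a factorization of S, so B is one of the given blocks.
    zeroSum-contains-block : IsUFIM G S → ∀ {m} {I : Vector (Subset N) m} → IsIrreducibleFactorization G S I →
                             ∀ J → Nonempty J → ZeroSum G S J → ∃[ i ] I i ⊆ J
    zeroSum-contains-block ufim {I = I} isF J ne zs
      with minimalZeroSum-⊆ J ne zs
    ... | B , B⊆J , neB , minB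
      with factorization-exists (⊤ ∩ ∁ B) (remainder-zeroSum Subset.⊆⊤ (IsUFIM.zeroSum ufim) (proj₁ minB))
    ... | m′ , I′ , F
      with proj₁ (IsUFIM.unique ufim {I = B ∷ᵇ I′} {I} isF′ isF) zero
      where
      module F′ = FactorizationOf (∷-factorization Subset.⊆⊤ neB minB F)
      isF′ : IsIrreducibleFactorization G S (B ∷ᵇ I′)
      isF′ = record
        { nonempty = F′.nonempty ; disjoint = F′.disjoint
        ; covers = λ x → F′.covers Subset.∈⊤ ; minimal = F′.minimal }
    ... | i , ≡.refl = i , B⊆J

    -- A nonempty zero-sum subset of the remaining indices would contain a whole block, including
    -- the element deleted from it.
    zeroSumFree-off-transversal : IsUFIM G S → ∀ {m} {I : Vector (Subset N) m} → IsIrreducibleFactorization G S I →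
      (x : Fin m → Fin N) → (∀ i → x i ∈ I i) → ZeroSumFree G (S ∘ select (∁ (image x)))
    zeroSumFree-off-transversal ufim isF x x∈I J (y , y∈J) zs =
      let X = ∁ (image x)
          i , I⊆ = zeroSum-contains-block ufim isF (embed X J) (select X y , select-∈-embed X J y∈J)
                     (trans (σ-embed S X J) zs)
      in Subset.x∈∁p⇒x∉p (embed-⊆ X J (I⊆ (x∈I i))) (∈-image x i)

  -- Orders of nonzero elements

  ord≢1 : ∀ {g} → ¬ g ≈ 0# → ord g ≢ 1
  ord≢1 {g} g≉0 ord≡1 = g≉0 (trans (sym (×-homo-1 g)) (≡.subst (λ n → n · g ≈ 0#) ord≡1 (ord-annihilates g)))

  -- The remainder of n modulo `ord g` also annihilates g, so it is zero by minimality of the order.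
  ord∣ : ∀ {g n} → n · g ≈ 0# → ord g ∣ n
  ord∣ {g} {n} ng≈0 = divides (n ℕ./ ord g)
    (≡.trans (m≡m%n+[m/n]*n n (ord g)) (≡.cong (ℕ._+ n ℕ./ ord g ℕ.* ord g) r≡0))
    where
    r = n ℕ.% ord g

    rg≈0 : r · g ≈ 0#
    rg≈0 = begin
      r · g                                  ≈⟨ identityʳ _ ⟨
      r · g ⊕ 0#                             ≈⟨ ∙-congˡ (×-ε commutativeMonoid (n ℕ./ ord g)) ⟨
      r · g ⊕ (n ℕ./ ord g) · 0#             ≈⟨ ∙-congˡ (×-congʳ (n ℕ./ ord g) (ord-annihilates g)) ⟨
      r · g ⊕ (n ℕ./ ord g) · (ord g · g)    ≈⟨ ∙-congˡ (×-assocˡ g (n ℕ./ ord g) (ord g)) ⟩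
      r · g ⊕ (n ℕ./ ord g ℕ.* ord g) · g    ≈⟨ ×-homo-+ g r _ ⟨
      (r ℕ.+ n ℕ./ ord g ℕ.* ord g) · g      ≡⟨ ≡.cong (_· g) (m≡m%n+[m/n]*n n (ord g)) ⟨
      n · g                                  ≈⟨ ng≈0 ⟩
      0#                                     ∎

    r≡0 : r ≡ 0
    r≡0 with r | rg≈0 | m%n<n n (ord g)
    ... | zero   | _    | _ = ≡.refl
    ... | suc r′ | r′g≈0 | r′<ord = contradiction r′g≈0 (ord-minimal g r′<ord)

  order-nonZero : NonZero order
  order-nonZero = ℕ.≢-nonZero λ order≡0 → contradiction (≡.subst Fin order≡0 (index 0#)) Fin.¬Fin0

  -- The smallest prime divisor of `ord g` also divides the group order, hence lies between
  -- `P⁻ order` and `ord g`.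
  P⁻≤ord : ∀ {g} → ¬ g ≈ 0# → P⁻ order ℕ.≤ ord g
  P⁻≤ord {g} g≉0 = ℕ.≤-trans (smallest prime (ℕ.∣-trans divides-ord ord∣order)) (ℕ.∣⇒≤ divides-ord)
    where
    instance _ = order-nonZero

    ord∣order : ord g ∣ order
    ord∣order = ord∣ (order-annihilates g)

    1<ord : 1 ℕ.< ord g
    1<ord = ℕ.≤∧≢⇒< (s≤s z≤n) (ord≢1 g≉0 ∘ ≡.sym)

    prime       = proj₁ (P⁻-smallestPrimeDivisor 1<ord)
    divides-ord = proj₁ (proj₂ (P⁻-smallestPrimeDivisor 1<ord))
    smallest : ∀ {q} → Prime q → q ∣ order → P⁻ order ℕ.≤ q
    smallest = proj₂ (proj₂ (P⁻-smallestPrimeDivisor (ℕ.<-≤-trans 1<ord (ℕ.∣⇒≤ ord∣order))))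

-- Rational arithmetic

open SemiringSum (CommutativeRing.semiring ℚ.+-*-commutativeRing)
  using (∑-distrib-+; *-distribʳ-sum) renaming (sum-cong-≗ to ∑-cong)

∑-mono : {f g : Vector ℚ N} → (∀ i → f i ℚ.≤ g i) → ∑[ i < N ] f i ℚ.≤ ∑[ i < N ] g i
∑-mono {zero}  f≤g = ℚ.≤-refl
∑-mono {suc n} f≤g = ℚ.+-mono-≤ (f≤g zero) (∑-mono (f≤g ∘ suc))

/-≡ : ∀ a b c d .{{_ : NonZero b}} .{{_ : NonZero d}} → a ℕ.* d ≡ c ℕ.* b → + a / b ≡ + c / d
/-≡ a (suc b′) c (suc d′) eq = ℚ.fromℚᵘ-cong {mkℚᵘ (+ a) b′} {mkℚᵘ (+ c) d′}
  (*≡* (≡.trans (≡.sym (ℤ.pos-* a _)) (≡.trans (≡.cong +_ eq) (ℤ.pos-* c _))))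

/-≤ : ∀ a b c d .{{_ : NonZero b}} .{{_ : NonZero d}} → a ℕ.* d ℕ.≤ c ℕ.* b → + a / b ℚ.≤ + c / d
/-≤ a (suc b′) c (suc d′) le = ℚ.toℚᵘ-cancel-≤ (ℚᵘ.≤-respˡ-≃ (ℚᵘ.≃-sym (ℚ.toℚᵘ-fromℚᵘ (mkℚᵘ (+ a) b′)))
  (ℚᵘ.≤-respʳ-≃ (ℚᵘ.≃-sym (ℚ.toℚᵘ-fromℚᵘ (mkℚᵘ (+ c) d′)))
    (*≤* (≡.subst₂ ℤ._≤_ (ℤ.pos-* a _) (ℤ.pos-* c _) (ℤ.+≤+ le)))))

/-+ : ∀ a b c d .{{_ : NonZero b}} .{{_ : NonZero d}} →
  + a / b ℚ.+ + c / d ≡ ((+ (a ℕ.* d ℕ.+ c ℕ.* b)) / (b ℕ.* d)) {{ℕ.m*n≢0 b d}}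
/-+ a (suc b′) c (suc d′) = ℚ.toℚᵘ-injective (begin
  toℚᵘ (ℚ.fromℚᵘ x ℚ.+ ℚ.fromℚᵘ y)              ≈⟨ ℚ.toℚᵘ-homo-+ (ℚ.fromℚᵘ x) (ℚ.fromℚᵘ y) ⟩
  toℚᵘ (ℚ.fromℚᵘ x) ℚᵘ.+ toℚᵘ (ℚ.fromℚᵘ y)      ≈⟨ ℚᵘ.+-cong (ℚ.toℚᵘ-fromℚᵘ x) (ℚ.toℚᵘ-fromℚᵘ y) ⟩
  x ℚᵘ.+ y                                      ≡⟨ ≡.cong (λ t → mkℚᵘ t _) (≡.trans
                                                     (≡.cong₂ ℤ._+_ (≡.sym (ℤ.pos-* a _)) (≡.sym (ℤ.pos-* c _)))
                                                     (≡.sym (ℤ.pos-+ (a ℕ.* suc d′) _))) ⟩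
  mkℚᵘ (+ (a ℕ.* suc d′ ℕ.+ c ℕ.* suc b′)) _    ≈⟨ ℚ.toℚᵘ-fromℚᵘ _ ⟨
  toℚᵘ (+ (a ℕ.* suc d′ ℕ.+ c ℕ.* suc b′) / (suc b′ ℕ.* suc d′)) ∎)
  where
  open ℚᵘ.≃-Reasoning
  x = mkℚᵘ (+ a) b′
  y = mkℚᵘ (+ c) d′

/-* : ∀ a b c d .{{_ : NonZero b}} .{{_ : NonZero d}} →
  (+ a / b) ℚ.* (+ c / d) ≡ ((+ (a ℕ.* c)) / (b ℕ.* d)) {{ℕ.m*n≢0 b d}}
/-* a (suc b′) c (suc d′) = ℚ.toℚᵘ-injective (begin
  toℚᵘ (ℚ.fromℚᵘ x ℚ.* ℚ.fromℚᵘ y)              ≈⟨ ℚ.toℚᵘ-homo-* (ℚ.fromℚᵘ x) (ℚ.fromℚᵘ y) ⟩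
  toℚᵘ (ℚ.fromℚᵘ x) ℚᵘ.* toℚᵘ (ℚ.fromℚᵘ y)      ≈⟨ ℚᵘ.*-cong (ℚ.toℚᵘ-fromℚᵘ x) (ℚ.toℚᵘ-fromℚᵘ y) ⟩
  x ℚᵘ.* y                                      ≡⟨ ≡.cong (λ t → mkℚᵘ t _) (≡.sym (ℤ.pos-* a c)) ⟩
  mkℚᵘ (+ (a ℕ.* c)) _                          ≈⟨ ℚ.toℚᵘ-fromℚᵘ _ ⟨
  toℚᵘ (+ (a ℕ.* c) / (suc b′ ℕ.* suc d′))      ∎)
  where
  open ℚᵘ.≃-Reasoning
  x = mkℚᵘ (+ a) b′
  y = mkℚᵘ (+ c) d′

toℚ : ℕ → ℚ
toℚ a = + a / 1

toℚ-+ : ∀ a b → toℚ (a ℕ.+ b) ≡ toℚ a ℚ.+ toℚ b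
toℚ-+ a b = ≡.trans (≡.cong toℚ (≡.cong₂ ℕ._+_ (≡.sym (ℕ.*-identityʳ a)) (≡.sym (ℕ.*-identityʳ b))))
  (≡.sym (/-+ a 1 b 1))

toℚ-∑ : (f : Vector ℕ N) → ∑[ i < N ] toℚ (f i) ≡ toℚ (∑ℕ f)
toℚ-∑ {zero}  f = ≡.refl
toℚ-∑ {suc n} f = ≡.trans (≡.cong (toℚ (f zero) ℚ.+_) (toℚ-∑ (f ∘ suc))) (≡.sym (toℚ-+ (f zero) _))

toℚ-mono : ∀ {a b} → a ℕ.≤ b → toℚ a ℚ.≤ toℚ b
toℚ-mono {a} {b} a≤b = /-≤ a 1 b 1 (ℕ.*-monoˡ-≤ 1 a≤b)

∑-replicate : ∀ n z → ∑[ i < n ] z ≡ toℚ n ℚ.* z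
∑-replicate zero    z = ≡.sym (ℚ.*-zeroˡ z)
∑-replicate (suc n) z = ≡.trans (≡.cong (z ℚ.+_) (∑-replicate n z))
  (≡.sym (≡.trans (≡.cong (ℚ._* z) (toℚ-+ 1 n))
    (≡.trans (ℚ.*-distribʳ-+ z ℚ.1ℚ (toℚ n)) (≡.cong (ℚ._+ toℚ n ℚ.* z) (ℚ.*-identityˡ z)))))

/-via-toℚ : ∀ a h .{{_ : NonZero h}} → + a / h ≡ toℚ a ℚ.* (+ 1 / h)
/-via-toℚ a h = ≡.sym (≡.trans (/-* a 1 1 h)
  (/-≡ (a ℕ.* 1) (1 ℕ.* h) a h {{ℕ.m*n≢0 1 h}} (≡.cong₂ ℕ._*_ (ℕ.*-identityʳ a) (≡.sym (ℕ.*-identityˡ h)))))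

rescale : ∀ a b s h .{{_ : NonZero b}} .{{_ : NonZero h}} → b ℕ.* s ≡ h → + a / b ≡ toℚ (a ℕ.* s) ℚ.* (+ 1 / h)
rescale a b s h bs≡h = ≡.trans (/-≡ a b (a ℕ.* s) h (begin
  a ℕ.* h           ≡⟨ ≡.cong (a ℕ.*_) bs≡h ⟨
  a ℕ.* (b ℕ.* s)   ≡⟨ rearrange a b s ⟩
  a ℕ.* s ℕ.* b     ∎)) (/-via-toℚ (a ℕ.* s) h)
  where
  open ≡.≡-Reasoning
  rearrange : ∀ a b s → a ℕ.* (b ℕ.* s) ≡ a ℕ.* s ℕ.* b
  rearrange = solve-∀

-- k* + K₁*/p = K₁* for one summand, with E = pᵉ, P = pᵉ⁻¹ and B = pᵉ - pᵉ⁻¹.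
combine : ∀ a p P E B q .{{_ : NonZero p}} .{{_ : NonZero E}} .{{_ : NonZero B}} .{{_ : NonZero q}} →
  E ≡ p ℕ.* P → E ≡ B ℕ.+ P →
  + a / E ℚ.+ ((+ q / p) ℚ.* (+ a / B)) ℚ.* (+ 1 / q) ≡ + a / B
combine a p P E B q E≡pP E≡B+P = begin
  + a / E ℚ.+ ((+ q / p) ℚ.* (+ a / B)) ℚ.* (+ 1 / q)
    ≡⟨ ≡.cong (λ t → + a / E ℚ.+ t ℚ.* (+ 1 / q)) (/-* q p a B) ⟩
  + a / E ℚ.+ (+ (q ℕ.* a) / (p ℕ.* B)) ℚ.* (+ 1 / q)
    ≡⟨ ≡.cong (+ a / E ℚ.+_) (/-* (q ℕ.* a) (p ℕ.* B) 1 q) ⟩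
  + a / E ℚ.+ + (q ℕ.* a ℕ.* 1) / (p ℕ.* B ℕ.* q)
    ≡⟨ /-+ a E (q ℕ.* a ℕ.* 1) (p ℕ.* B ℕ.* q) ⟩
  + (a ℕ.* (p ℕ.* B ℕ.* q) ℕ.+ q ℕ.* a ℕ.* 1 ℕ.* E) / (E ℕ.* (p ℕ.* B ℕ.* q))
    ≡⟨ /-≡ (a ℕ.* (p ℕ.* B ℕ.* q) ℕ.+ q ℕ.* a ℕ.* 1 ℕ.* E) (E ℕ.* (p ℕ.* B ℕ.* q)) a B cross ⟩
  + a / B ∎
  where
  open ≡.≡-Reasoning
  instance
    pB≢0 : NonZero (p ℕ.* B)
    pB≢0 = ℕ.m*n≢0 p B
    pBq≢0 : NonZero (p ℕ.* B ℕ.* q)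
    pBq≢0 = ℕ.m*n≢0 (p ℕ.* B) q
    EpBq≢0 : NonZero (E ℕ.* (p ℕ.* B ℕ.* q))
    EpBq≢0 = ℕ.m*n≢0 E (p ℕ.* B ℕ.* q)

  before : ∀ a p E B q → (a ℕ.* (p ℕ.* B ℕ.* q) ℕ.+ q ℕ.* a ℕ.* 1 ℕ.* E) ℕ.* B ≡ a ℕ.* q ℕ.* B ℕ.* (p ℕ.* B ℕ.+ E)
  before = solve-∀

  after : ∀ a p E B q → a ℕ.* q ℕ.* B ℕ.* (p ℕ.* E) ≡ a ℕ.* (E ℕ.* (p ℕ.* B ℕ.* q))
  after = solve-∀

  -- After clearing denominators this is all that remains: 1/E + 1/(p B) = 1/B amounts to p B + E =
  -- p E.
  telescope : p ℕ.* B ℕ.+ E ≡ p ℕ.* E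
  telescope = ≡.trans (≡.cong (p ℕ.* B ℕ.+_) E≡pP)
    (≡.trans (≡.sym (ℕ.*-distribˡ-+ p B P)) (≡.cong (p ℕ.*_) (≡.sym E≡B+P)))

  cross : (a ℕ.* (p ℕ.* B ℕ.* q) ℕ.+ q ℕ.* a ℕ.* 1 ℕ.* E) ℕ.* B ≡ a ℕ.* (E ℕ.* (p ℕ.* B ℕ.* q))
  cross = ≡.trans (before a p E B q) (≡.trans (≡.cong (a ℕ.* q ℕ.* B ℕ.*_) telescope) (after a p E B q))

-- Cross numbers

module _ {p e : ℕ} (pp : Prime p) (e≥1 : 1 ℕ.≤ e) where

  private
    E = p ^ e
    P = p ^ (e ∸ 1)

    instance
      p≢0 : NonZero p
      p≢0 = prime⇒nonZero pp

      E≢0 : NonZero E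
      E≢0 = ℕ.m^n≢0 p e

    P<E : P ℕ.< E
    P<E = ℕ.^-monoʳ-< p (ℕ.nonTrivial⇒n>1 p {{prime⇒nonTrivial pp}}) (ℕ.∸-monoʳ-< ℕ.z<s e≥1)

    instance
      E∸P≢0 : NonZero (E ∸ P)
      E∸P≢0 = ℕ.>-nonZero (ℕ.m<n⇒0<n∸m P<E)

  -- The factor q cancels; it is carried along to match the summands of `weightedK₁*`.
  k*+K₁*/p≡K₁* : ∀ q .{{_ : NonZero q}} →
    k*-cyclic pp e≥1 ℚ.+ ((+ q / p) ℚ.* K₁*-cyclic pp e≥1) ℚ.* (+ 1 / q) ≡ K₁*-cyclic pp e≥1
  k*+K₁*/p≡K₁* q = combine (E ∸ 1) p P E (E ∸ P) q
    (≡.cong (p ^_) (≡.sym (ℕ.m+[n∸m]≡n e≥1))) (≡.sym (ℕ.m∸n+n≡m (ℕ.<⇒≤ P<E)))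

  k*-cyclic-rescaled : ∀ s h .{{_ : NonZero h}} → E ℕ.* s ≡ h →
    k*-cyclic pp e≥1 ≡ toℚ (ℕ.pred E ℕ.* s) ℚ.* (+ 1 / h)
  k*-cyclic-rescaled s h = rescale (E ∸ 1) E s h

module _ (D : PrimePowers) where
  open PrimePowers D

  k*+weightedK₁*/q≡K₁* : ∀ q .{{_ : NonZero q}} → k* D ℚ.+ weightedK₁* D q ℚ.* (+ 1 / q) ≡ K₁* D
  k*+weightedK₁*/q≡K₁* q = begin
    k* D ℚ.+ weightedK₁* D q ℚ.* z
      ≡⟨ ≡.cong (k* D ℚ.+_) (≡.trans (*-distribʳ-sum z (λ i → ∑[ j < r i ] W i j)) (∑-cong λ i → *-distribʳ-sum z (W i))) ⟩
    k* D ℚ.+ (∑[ i < n ] ∑[ j < r i ] (W i j ℚ.* z))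
      ≡⟨ ∑-distrib-+ (λ i → ∑[ j < r i ] κ i j) (λ i → ∑[ j < r i ] (W i j ℚ.* z)) ⟨
    ∑[ i < n ] ((∑[ j < r i ] κ i j) ℚ.+ (∑[ j < r i ] (W i j ℚ.* z)))
      ≡⟨ ∑-cong (λ i → ≡.trans (≡.sym (∑-distrib-+ (κ i) (λ j → W i j ℚ.* z)))
           (∑-cong λ j → k*+K₁*/p≡K₁* (p-prime i) (e≥1 i j) q)) ⟩
    K₁* D ∎
    where
    open ≡.≡-Reasoning
    z = + 1 / q

    κ W : ∀ i → Fin (r i) → ℚ
    κ i j = k*-cyclic (p-prime i) (e≥1 i j)
    W i j = _/_ (+ q) (p i) {{prime⇒nonZero (p-prime i)}} ℚ.* K₁*-cyclic (p-prime i) (e≥1 i j)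

module _ (G : FiniteAbelianGroup c ℓ) (D : PrimePowers) where
  open FiniteAbelianGroup G
  open PrimePowers D

  -- The common core of both statements: q is the smallest prime divisor of the group order in the
  -- general case, and p for a p-group.
  k≤K₁* : ∀ q .{{_ : NonZero q}} → (∀ {g} → ¬ g ≈ 0# → q ℕ.≤ ord g) →
    (∀ {N} (S : Vector Carrier N) → OverNonzero G S → ZeroSumFree G S → k G S ≤ k* D) →
    ∀ {N m} (S : Vector Carrier N) (I : Vector (Subset N) m) → IsUFIM G S → IsIrreducibleFactorization G S I →
    + m / 1 ≤ weightedK₁* D q → k G S ≤ K₁* D
  k≤K₁* q q≤ord bound {N} {m} S I ufim isF m≤ = begin
    k G S
      ≡⟨ sum-split ℚ.+-0-commutativeMonoid Y (λ x → + 1 / ord (S x)) ⟩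
    k G (S ∘ select Y) ℚ.+ k G (S ∘ select (∁ Y))
      ≤⟨ ℚ.+-mono-≤ removed (bound (S ∘ select (∁ Y)) (IsUFIM.overNonzero ufim ∘ select (∁ Y)) free) ⟩
    weightedK₁* D q ℚ.* (+ 1 / q) ℚ.+ k* D
      ≡⟨ ℚ.+-comm _ (k* D) ⟩
    k* D ℚ.+ weightedK₁* D q ℚ.* (+ 1 / q)
      ≡⟨ k*+weightedK₁*/q≡K₁* D q ⟩
    K₁* D ∎
    where
    open ℚ.≤-Reasoning
    module F = IsIrreducibleFactorization isF

    -- The deleted transversal: the witness of nonemptiness of each block.
    x : Fin m → Fin N
    x i = proj₁ (F.nonempty i)

    Y = image x

    free : ZeroSumFree G (S ∘ select (∁ Y))
    free = zeroSumFree-off-transversal G S ufim isF x (λ i → proj₂ (F.nonempty i))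

    instance
      1/q≥0 : ℚ.NonNegative (+ 1 / q)
      1/q≥0 = ℚ.normalize-nonNeg 1 q

    removed : k G (S ∘ select Y) ≤ weightedK₁* D q ℚ.* (+ 1 / q)
    removed = begin
      k G (S ∘ select Y)                     ≤⟨ ∑-mono {∣ Y ∣} (λ y → /-≤ 1 (ord (S (select Y y))) 1 q
                                                  (ℕ.*-monoʳ-≤ 1 (q≤ord (IsUFIM.overNonzero ufim (select Y y))))) ⟩
      ∑[ y < ∣ Y ∣ ] (+ 1 / q)               ≡⟨ ∑-replicate ∣ Y ∣ (+ 1 / q) ⟩
      toℚ ∣ Y ∣ ℚ.* (+ 1 / q)                ≤⟨ ℚ.*-monoʳ-≤-nonNeg (+ 1 / q) (ℚ.≤-trans (toℚ-mono (∣image∣≤ x)) m≤) ⟩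
      weightedK₁* D q ℚ.* (+ 1 / q)          ∎

  -- The cross number bound for p-groups

  module _ (iso : abelianGroup ≅ ⨁ D) {p₀ : ℕ} (pp : Prime p₀) (isPGroup : IsPGroup G p₀) where

    private
      instance
        p₀≢0 : NonZero p₀
        p₀≢0 = prime⇒nonZero pp

    open Coordinates G D iso

    prime≤ord : ∀ {g} → ¬ g ≈ 0# → p₀ ℕ.≤ ord g
    prime≤ord {g} g≉0 with isPGroup g
    ... | zero  , ord≡1 = contradiction ord≡1 (ord≢1 G g≉0)
    ... | suc a , ord≡  = ≡.subst (p₀ ℕ.≤_) (≡.sym ord≡) (ℕ.m≤m*n p₀ (p₀ ^ a) {{ℕ.m^n≢0 p₀ a}})

    -- All primes `p i` equal p₀, so every weight is 1.
    K₁*≡weightedK₁* : K₁* D ≡ weightedK₁* D p₀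
    K₁*≡weightedK₁* = ∑-cong λ i → ∑-cong λ j → ≡.trans (≡.sym (ℚ.*-identityˡ _))
      (≡.cong (ℚ._* K₁*-cyclic (p-prime i) (e≥1 i j))
        (/-≡ 1 1 p₀ (p i) {{_}} {{prime⇒nonZero (p-prime i)}}
          (≡.trans (ℕ.*-identityˡ (p i)) (≡.trans (p-unique pp isPGroup (i , j)) (≡.sym (ℕ.*-identityʳ p₀))))))

    -- Both sides are written over the common denominator `p₀ ^ h`, which reduces the claim to the
    -- inequality of integer weights.
    zeroSumFree⇒k≤k* : ∀ {N} (S : Vector Carrier N) → ZeroSumFree G S → k G S ≤ k* D
    zeroSumFree⇒k≤k* {N} S free = begin
      k G S
        ≡⟨ ∑-cong (λ x → 1/ord≡ x) ⟩
      ∑[ x < N ] (toℚ (cost x) ℚ.* z)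
        ≡⟨ *-distribʳ-sum z (toℚ ∘ cost) ⟨
      (∑[ x < N ] toℚ (cost x)) ℚ.* z
        ≡⟨ ≡.cong (ℚ._* z) (toℚ-∑ cost) ⟩
      toℚ (∑ℕ cost) ℚ.* z
        ≤⟨ ℚ.*-monoʳ-≤-nonNeg z (toℚ-mono (zeroSumFree⇒weights≤ pp isPGroup h S free α killed)) ⟩
      toℚ (∑ℕ λ i → ∑ℕ (weight i)) ℚ.* z
        ≡⟨ ≡.cong (ℚ._* z) (≡.trans (∑-cong λ i → toℚ-∑ (weight i)) (toℚ-∑ λ i → ∑ℕ (weight i))) ⟨
      (∑[ i < n ] ∑[ j < r i ] toℚ (weight i j)) ℚ.* z
        ≡⟨ *-distribʳ-sum z (λ i → ∑[ j < r i ] toℚ (weight i j)) ⟩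
      ∑[ i < n ] ((∑[ j < r i ] toℚ (weight i j)) ℚ.* z)
        ≡⟨ ∑-cong (λ i → *-distribʳ-sum z (toℚ ∘ weight i)) ⟩
      ∑[ i < n ] ∑[ j < r i ] (toℚ (weight i j) ℚ.* z)
        ≡⟨ ∑-cong (λ i → ∑-cong λ j → k*-cyclic-rescaled (p-prime i) (e≥1 i j) _ _ (pᵉ*weight i j)) ⟨
      k* D ∎
      where
      open ℚ.≤-Reasoning

      α : Fin N → ℕ
      α x = proj₁ (isPGroup (S x))

      ≤∑ : ∀ {l} (f : Fin l → ℕ) x → f x ℕ.≤ ∑ℕ f
      ≤∑ f zero    = ℕ.m≤m+n (f zero) _
      ≤∑ f (suc x) = ℕ.≤-trans (≤∑ (f ∘ suc) x) (ℕ.m≤n+m _ (f zero))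

      -- Any common bound on all exponents of p will do.
      h : ℕ
      h = ∑ℕ α ℕ.+ ∑ℕ λ i → ∑ℕ (e i)

      α≤h : ∀ x → α x ℕ.≤ h
      α≤h x = ℕ.≤-trans (≤∑ α x) (ℕ.m≤m+n _ _)

      e≤h : ∀ i j → e i j ℕ.≤ h
      e≤h i j = ℕ.≤-trans (≤∑ (e i) j) (ℕ.≤-trans (≤∑ (λ i → ∑ℕ (e i)) i) (ℕ.m≤n+m _ (∑ℕ α)))

      instance
        pʰ≢0 : NonZero (p₀ ^ h)
        pʰ≢0 = ℕ.m^n≢0 p₀ h

      z = + 1 / (p₀ ^ h)

      instance
        z≥0 : ℚ.NonNegative z
        z≥0 = ℚ.normalize-nonNeg 1 (p₀ ^ h)

      cost : Fin N → ℕ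
      cost x = p₀ ^ (h ∸ α x)

      weight : ∀ i → Fin (r i) → ℕ
      weight i j = ℕ.pred (p i ^ e i j) ℕ.* p₀ ^ (h ∸ e i j)

      ^-complement : ∀ {l} → l ℕ.≤ h → p₀ ^ l ℕ.* p₀ ^ (h ∸ l) ≡ p₀ ^ h
      ^-complement {l} l≤h = ≡.trans (≡.sym (ℕ.^-distribˡ-+-* p₀ l (h ∸ l))) (≡.cong (p₀ ^_) (ℕ.m+[n∸m]≡n l≤h))

      pᵉ*weight : ∀ i j → p i ^ e i j ℕ.* p₀ ^ (h ∸ e i j) ≡ p₀ ^ h
      pᵉ*weight i j = ≡.trans (≡.cong (λ q → q ^ e i j ℕ.* p₀ ^ (h ∸ e i j)) (p-unique pp isPGroup (i , j))) (^-complement (e≤h i j))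

      killed : ∀ x → (p₀ ^ α x) · S x ≈ 0#
      killed x = ≡.subst (λ m → m · S x ≈ 0#) (proj₂ (isPGroup (S x))) (ord-annihilates (S x))

      1/ord≡ : ∀ x → + 1 / ord (S x) ≡ toℚ (cost x) ℚ.* z
      1/ord≡ x = ≡.trans
        (rescale 1 (ord (S x)) (cost x) (p₀ ^ h)
          (≡.trans (≡.cong (ℕ._* cost x) (proj₂ (isPGroup (S x)))) (^-complement (α≤h x))))
        (≡.cong (λ m → toℚ m ℚ.* z) (ℕ.*-identityˡ (cost x)))

proposition30 : {c ℓ : Level} (G : FiniteAbelianGroup c ℓ) (D : PrimePowers) →
    let open FiniteAbelianGroup G in
    abelianGroup ≅ ⨁ D →
    (k[ G ]≡ k* D →
    {N m : ℕ} (S : Vector Carrier N) (I : Vector (Subset N) m) →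
    IsUFIM G S → IsIrreducibleFactorization G S I →
    + m / 1 ≤ weightedK₁* D (P⁻ order) →
    k G S ≤ K₁* D)
    ×
    ((p : ℕ) → Prime p → IsPGroup G p →
    {N m : ℕ} (S : Vector Carrier N) (I : Vector (Subset N) m) →
    IsUFIM G S → IsIrreducibleFactorization G S I →
    + m / 1 ≤ K₁* D →
    k G S ≤ K₁* D)
proposition30 G D iso =
  (λ max → k≤K₁* G D (P⁻ order) {{P⁻-nonZero order {{order-nonZero G}}}} (P⁻≤ord G)
    λ S over free → proj₂ max (_ , S , over , free , ≡.refl)) ,
  λ p pp isPGroup {_} {m} S I ufim isF m≤ →
    k≤K₁* G D p {{prime⇒nonZero pp}} (prime≤ord G D iso pp isPGroup)
      (λ S _ free → zeroSumFree⇒k≤k* G D iso pp isPGroup S free) S I ufim isF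
      (≡.subst (+ m / 1 ≤_) (K₁*≡weightedK₁* G D iso pp isPGroup) m≤)
  where
  open FiniteAbelianGroup G

  -- The search defining `P⁻` starts at 0, which is not prime, so on a successor its value computes
  -- to a successor; this includes the value 1 for the trivial group.
  P⁻-nonZero : ∀ m .{{_ : NonZero m}} → NonZero (P⁻ m)
  P⁻-nonZero (suc m) = _
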